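{- Let $M=(E,\mathcal I)$ be a matroid, let $w:E\to\mathbb R$ be a weight function, let $E_0\subset E$ be a subset that contains a basis of $M$, and let $T=|E\setminus E_0|$. Then the simplified greedy algorithm described in the context finds an optimal solution for the problem IMD-MWB, i.e., for the incremental matroid design problem with minimum weight bases $$\min\left\{\sum_{i=0}^T f(A_i)\ :\ A_0=\emptyset,\ |A_i\setminus A_{i-1}|=1\text{ for }i=1,\ldots,T\right\}.$$
   Context: For a set $A$ and an element $e$ write $A+e=A\cup\{e\}$ and $A-e=A\setminus\{e\}$. The weight function is extended to subsets $X\subseteq E$ by $w(X)=\sum_{e\in X}w(e)$. For $A\subseteq E\setminus E_0$ let $$f(A)=\min\{w(X)\ :\ X\subseteq E_0\cup A\text{ is a basis of }M\}.$$ The incremental matroid design problem with minimum weight bases (IMD-MWB) for the time horizon $T=|E\setminus E_0|$ is the minimization problem displayed in the claim, where the $A_i$ are subsets of $E\setminus E_0$. For a basis $X$ of $M$, a pair $(e,e')\in X\times(E\setminus X)$ is called an exchange pair for $X$ if $X-e+e'$ is another basis. For $Y\subseteq E$, an exchange pair for $(X,Y)$ is an exchange pair $(e,e')$ for $X$ whose second component $e'$ belongs to $Y\setminus X$; it is called optimal if $w(e)-w(e')$ is maximum among the exchange pairs for $(X,Y)$. Simplified greedy algorithm: Let $X$ be any minimum weight basis of the submatroid induced by $E_0$, and let $Y$ be any minimum weight basis of the matroid $M$ (kept fixed throughout). For $k=1,\ldots,|Y\setminus X|$ do: let $(e,e')$ be an optimal exchange pair for $(X,Y)$; set $X\leftarrow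 X-e+e'$; set $e'_k\leftarrow e'$. Return $(e'_1,\ldots,e'_k)$. The output $(e'_1,\ldots,e'_k)$ of the greedy strategy defines the sets $A_i$ via $A_0=\emptyset$, $A_i=\{e'_1,\ldots,e'_i\}$ for $i\leqslant k$, and $A_i=A_{i-1}+e'$ for arbitrary $e'\in E\setminus(E_0\cup A_{i-1})$ for $k+1\leqslant i\leqslant T$.
   Formalization: With tied weights the output may contain elements of E_0 or repeats, making the A_i infeasible; such entries are dropped before the A_i are formed. Weights lie in any linearly ordered abelian group with decidable order (classically including the reals), and independence is decidable. -}

module Defs where

open import Algebra.Bundles using (AbelianGroup)
open import Algebra.Properties.CommutativeMonoid.Sum as Sum using ()
open import Algebra.Structures using (IsAbelianGroup)
open import Data.Bool.Base using (if_then_else_)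
open import Data.Empty using (⊥-elim)
open import Data.Fin.Base using (Fin; zero; suc; toℕ; inject₁)
open import Data.Fin.Properties using (_≟_)
open import Data.Fin.Subset renaming (_-_ to _-ˢ_)
open import Data.Fin.Subset.Properties
  using (_∈?_; _⊆?_; anySubset?; ⊆-trans; ⊥⊆; x∈p∪q⁻; x∈⁅y⁆⇒x≡y; p⊆p∪q)
open import Data.List.Base
  using (List; []; _∷_; length; map; take; filter; deduplicate)
open import Data.Nat.Base as ℕ using (ℕ; zero; suc)
open import Data.Product.Base using (∃; _×_; _,_; proj₁; proj₂)
open import Data.Sum.Base using (_⊎_; inj₁; inj₂)
open import Data.Vec.Base using ([]; _∷_; lookup)
open import Function.Base using (_∘_)
open import Level using (Level; _⊔_)
open import Relation.Binary.Bundles using (DecTotalOrder)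
open import Relation.Binary.Core using (Rel)
open import Relation.Binary.PropositionalEquality.Core using (_≡_; sym; subst)
open import Relation.Binary.Structures using (IsDecTotalOrder)
open import Relation.Nullary.Decidable.Core using (yes; no; ¬?; _×-dec_)
open import Relation.Nullary.Negation.Core using (¬_)
open import Relation.Unary using (Pred; Decidable)

private
  variable
    n : ℕ

-- The weights.  The library has no real numbers; only the addition and the
-- linear order of ℝ matter here, so weights live in an arbitrary linearly
-- ordered abelian group.

record OrderedAbelianGroup c ℓ₁ ℓ₂ : Set (Level.suc (c ⊔ ℓ₁ ⊔ ℓ₂)) where
  infix  8 -_
  infixl 6 _+_ _-_
  infix  4 _≈_ _≤_
  field
    Carrier         : Set c
    _≈_             : Rel Carrier ℓ₁
    _≤_             : Rel Carrier ℓ₂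
    _+_             : Carrier → Carrier → Carrier
    0#              : Carrier
    -_              : Carrier → Carrier
    isAbelianGroup  : IsAbelianGroup _≈_ _+_ 0# -_
    isDecTotalOrder : IsDecTotalOrder _≈_ _≤_
    +-monoʳ-≤       : ∀ x {y z} → y ≤ z → x + y ≤ x + z

  abelianGroup : AbelianGroup c ℓ₁
  abelianGroup = record { isAbelianGroup = isAbelianGroup }

  decTotalOrder : DecTotalOrder c ℓ₁ ℓ₂
  decTotalOrder = record { isDecTotalOrder = isDecTotalOrder }

  open Sum (AbelianGroup.commutativeMonoid abelianGroup) public using (sum)

  _-_ : Carrier → Carrier → Carrier
  x - y = x + (- y)

-- Matroids on a ground set of n elements.  Independence is decidable, as it
-- always is classically.

record Matroid (n : ℕ) ℓ : Set (Level.suc ℓ) where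
  field
    Indep      : Pred (Subset n) ℓ
    indep?     : Decidable Indep
    ⊥-indep    : Indep ⊥
    hereditary : ∀ {X Y} → X ⊆ Y → Indep Y → Indep X
    augment    : ∀ {X Y} → Indep X → Indep Y → ∣ X ∣ ℕ.< ∣ Y ∣ →
                 ∃ λ e → e ∈ Y × e ∉ X × Indep (X ∪ ⁅ e ⁆)

IsBasis : ∀ {ℓ} → Matroid n ℓ → Pred (Subset n) ℓ
IsBasis M X = Indep X × (∀ Z → Indep Z → X ⊆ Z → Z ⊆ X)
  where open Matroid M

isBasis? : ∀ {ℓ} (M : Matroid n ℓ) → Decidable (IsBasis M)
isBasis? M X with indep? X | anySubset? (λ Z → indep? Z ×-dec X ⊆? Z ×-dec ¬? (Z ⊆? X))
  where open Matroid M
... | no ¬i | _                    = no λ b → ¬i (proj₁ b)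
... | yes i | yes (Z , j , s , ¬t) = no λ b → ¬t (proj₂ b Z j s)
... | yes i | no ¬larger           = yes (i , maximal)
  where
  maximal : ∀ Z → Matroid.Indep M Z → X ⊆ Z → Z ⊆ X
  maximal Z j s with Z ⊆? X
  ... | yes t = t
  ... | no ¬t = ⊥-elim (¬larger (Z , j , s , ¬t))

-- The submatroid induced by S, kept on the same ground set: the elements
-- outside S become loops, so it has the same independent sets and bases.

restrict : ∀ {ℓ} → Matroid n ℓ → Subset n → Matroid n ℓ
restrict M S = record
  { Indep      = λ X → Indep X × X ⊆ S
  ; indep?     = λ X → indep? X ×-dec X ⊆? S
  ; ⊥-indep    = ⊥-indep , ⊥⊆
  ; hereditary = λ X⊆Y (i , Y⊆S) → hereditary X⊆Y i , ⊆-trans X⊆Y Y⊆S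
  ; augment    = λ (i , X⊆S) (j , Y⊆S) lt → extend X⊆S Y⊆S (augment i j lt)
  }
  where
  open Matroid M
  extend : ∀ {X Y} → X ⊆ S → Y ⊆ S →
           (∃ λ e → e ∈ Y × e ∉ X × Indep (X ∪ ⁅ e ⁆)) →
           ∃ λ e → e ∈ Y × e ∉ X × (Indep (X ∪ ⁅ e ⁆) × X ∪ ⁅ e ⁆ ⊆ S)
  extend {X} {Y} X⊆S Y⊆S (e , e∈Y , e∉X , k) = e , e∈Y , e∉X , k , sub
    where
    sub : X ∪ ⁅ e ⁆ ⊆ S
    sub x∈ with x∈p∪q⁻ X ⁅ e ⁆ x∈
    ... | inj₁ x∈X = X⊆S x∈X
    ... | inj₂ x∈e = subst (_∈ S) (sym (x∈⁅y⁆⇒x≡y e x∈e)) (Y⊆S e∈Y)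

module Minimum {c ℓ₁ ℓ₂} (W : OrderedAbelianGroup c ℓ₁ ℓ₂) where
  private module W = OrderedAbelianGroup W
  open DecTotalOrder W.decTotalOrder using (total; trans)
    renaming (refl to ≤-refl)

  IsMinimiser : ∀ {p} → (Subset n → W.Carrier) → Pred (Subset n) p → Pred (Subset n) _
  IsMinimiser g P X = P X × (∀ Z → P Z → g X W.≤ g Z)

  private
    search : ∀ {p} (g : Subset n → W.Carrier) {P : Pred (Subset n) p} →
             Decidable P → ∃ (IsMinimiser g P) ⊎ (∀ X → ¬ P X)
    search {n = zero} g P? with P? []
    ... | yes p = inj₁ ([] , p , λ { [] _ → ≤-refl })
    ... | no ¬p = inj₂ λ { [] → ¬p }
    search {n = suc _} g P?
      with search (g ∘ (inside ∷_)) (P? ∘ (inside ∷_))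
         | search (g ∘ (outside ∷_)) (P? ∘ (outside ∷_))
    ... | inj₂ no₁ | inj₂ no₂ =
      inj₂ λ { (inside ∷ Z) → no₁ Z ; (outside ∷ Z) → no₂ Z }
    ... | inj₁ (X , p , m) | inj₂ no₂ =
      inj₁ (_ , p , λ { (inside ∷ Z) → m Z ; (outside ∷ Z) q → ⊥-elim (no₂ Z q) })
    ... | inj₂ no₁ | inj₁ (X , p , m) =
      inj₁ (_ , p , λ { (inside ∷ Z) q → ⊥-elim (no₁ Z q) ; (outside ∷ Z) → m Z })
    ... | inj₁ (X₁ , p₁ , m₁) | inj₁ (X₂ , p₂ , m₂)
      with total (g (inside ∷ X₁)) (g (outside ∷ X₂))
    ... | inj₁ le = inj₁ (_ , p₁ , λ { (inside ∷ Z) → m₁ Z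
                                     ; (outside ∷ Z) q → trans le (m₂ Z q) })
    ... | inj₂ ge = inj₁ (_ , p₂ , λ { (inside ∷ Z) q → trans ge (m₁ Z q)
                                     ; (outside ∷ Z) → m₂ Z })

  minimiser : ∀ {p} (g : Subset n → W.Carrier) {P : Pred (Subset n) p} →
              Decidable P → ∃ P → ∃ (IsMinimiser g P)
  minimiser g P? (X , p) with search g P?
  ... | inj₁ m  = m
  ... | inj₂ ¬p = ⊥-elim (¬p X p)

module IMD
  {c ℓ₁ ℓ₂ ℓ : Level} (W : OrderedAbelianGroup c ℓ₁ ℓ₂)
  {n : ℕ} (M : Matroid n ℓ)
  (w : Fin n → OrderedAbelianGroup.Carrier W)
  (E₀ : Subset n)
  (spanning : ∃ λ B → IsBasis M B × B ⊆ E₀)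
  where

  private module W = OrderedAbelianGroup W
  open Minimum W public

  weight : Subset n → W.Carrier
  weight X = W.sum λ e → if lookup X e then w e else W.0#

  IsMinWeightBasis : Matroid n ℓ → Pred (Subset n) _
  IsMinWeightBasis N = IsMinimiser weight (IsBasis N)

  -- The sets over which f A is the minimum weight.
  BasisWithin : Subset n → Pred (Subset n) ℓ
  BasisWithin A X = IsBasis M X × X ⊆ E₀ ∪ A

  best : ∀ A → ∃ (IsMinimiser weight (BasisWithin A))
  best A = minimiser weight (λ X → isBasis? M X ×-dec X ⊆? (E₀ ∪ A)) start
    where
    start : ∃ (BasisWithin A)
    start = let B , b , B⊆E₀ = spanning in B , b , ⊆-trans B⊆E₀ (p⊆p∪q A)

  f : Subset n → W.Carrier
  f A = weight (proj₁ (best A))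

  T : ℕ
  T = ∣ ∁ E₀ ∣

  Sequence : Set
  Sequence = Fin (suc T) → Subset n

  -- A (inject₁ i) and A (suc i) are consecutive members of the sequence.
  Feasible : Pred Sequence _
  Feasible A =
    (∀ i → A i ⊆ ∁ E₀) ×
    A zero ≡ ⊥ ×
    (∀ (i : Fin T) → ∣ A (suc i) ─ A (inject₁ i) ∣ ≡ 1)

  cost : Sequence → W.Carrier
  cost A = W.sum (f ∘ A)

  Optimal : Pred Sequence _
  Optimal A = Feasible A × (∀ B → Feasible B → cost A W.≤ cost B)

  swap : Subset n → Fin n → Fin n → Subset n
  swap X e e′ = (X -ˢ e) ∪ ⁅ e′ ⁆

  ExchangePair : Subset n → Fin n → Fin n → Set ℓ
  ExchangePair X e e′ = e ∈ X × e′ ∉ X × IsBasis M (swap X e e′)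

  ExchangePairFor : Subset n → Subset n → Fin n → Fin n → Set ℓ
  ExchangePairFor X Y e e′ = ExchangePair X e e′ × e′ ∈ Y ─ X

  OptimalExchangePair : Subset n → Subset n → Fin n → Fin n → Set _
  OptimalExchangePair X Y e e′ =
    ExchangePairFor X Y e e′ ×
    (∀ d d′ → ExchangePairFor X Y d d′ → w d W.- w d′ W.≤ w e W.- w e′)

  -- Steps Y X es X′: some iterations of the loop lead from X to X′ and record
  -- the elements es, in this order.
  data Steps (Y : Subset n) : Subset n → List (Fin n) → Subset n → Set (c ⊔ ℓ₁ ⊔ ℓ₂ ⊔ ℓ) where
    done : ∀ {X} → Steps Y X [] X
    step : ∀ {X e e′ es X′} → OptimalExchangePair X Y e e′ →
           Steps Y (swap X e e′) es X′ → Steps Y X (e′ ∷ es) X′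

  -- The number of iterations is fixed by the initial X.
  Output : Subset n → Subset n → List (Fin n) → Set _
  Output X Y es = length es ≡ ∣ Y ─ X ∣ × ∃ (Steps Y X es)

  -- When weights tie, an optimal exchange pair can have e′ ∈ E₀, or bring back
  -- an element that was recorded and removed earlier, and such an e′ cannot be
  -- added to a subset of E ∖ E₀.  For example, let a, b, c be parallel elements
  -- of equal weight, E₀ = {a, b}, X = {a} and Y = {b}: then the output is (b).
  -- These entries are dropped; an output of distinct elements of E ∖ E₀ is
  -- left unchanged.
  proper : List (Fin n) → List (Fin n)
  proper = deduplicate _≟_ ∘ filter (λ e → ¬? (e ∈? E₀))

  -- Aᵢ = {e′₁, …, e′ᵢ} for i ≤ k, and an arbitrary new element is added in each
  -- later step.
  Induces : List (Fin n) → Sequence → Set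
  Induces es A =
    (∀ i → toℕ i ℕ.≤ length es → A i ≡ ⋃ (map ⁅_⁆ (take (toℕ i) es))) ×
    (∀ (i : Fin T) → length es ℕ.≤ toℕ i →
      ∃ λ e′ → e′ ∉ E₀ ∪ A (inject₁ i) × A (suc i) ≡ A (inject₁ i) ∪ ⁅ e′ ⁆)

{-# OPTIONS --safe #-}

-- Charge every element outside E₀ a fee θ ≥ 0.  If X is a minimum weight basis for the
-- charged weights and has i elements outside E₀, then X is cheapest, for w, among all bases
-- with at most i elements outside E₀, and so f(Aᵢ) ≤ f(Bᵢ) for every feasible sequence B.
-- An optimal exchange of positive gain μ swaps an element of E₀ for one outside E₀; by
-- symmetric exchange with the minimum weight basis Y no exchange at all gains more than μ,
-- so X stays optimal when the fee is lowered from θ to μ, and at that fee the exchange is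
-- free of cost.  Once the optimal gain is not positive, X is a minimum weight basis of M.

module Submission where

open import Defs
open import Algebra.Bundles using (AbelianGroup)
import Algebra.Properties.CommutativeMonoid.Sum as Sum
import Algebra.Properties.CommutativeSemigroup as CommutativeSemigroupProperties
import Algebra.Properties.Monoid.Mult as Mult
import Algebra.Properties.Group as GroupProperties
open import Data.Bool.Base using (true; false; if_then_else_)
open import Data.Empty using (⊥-elim)
open import Data.Fin.Base using (Fin; zero; suc; toℕ; inject₁)
open import Data.Fin.Induction using (<-weakInduction)
open import Data.Fin.Properties using (_≟_; any?; toℕ-inject₁; toℕ<n)
open import Data.Fin.Subset renaming (_-_ to _-ˢ_)
open import Data.Fin.Subset.Properties
open import Data.List.Base
  using (List; []; _∷_; _++_; length; map; take; filter; deduplicate; allFin; cartesianProduct; tabulate)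
open import Data.List.Extrema as Extrema using ()
open import Data.List.Membership.Propositional using () renaming (_∈_ to _∈ˡ_)
open import Data.List.Membership.Propositional.Properties
  using (∈-filter⁺; ∈-allFin; ∈-cartesianProduct⁺; ∈-++⁺ʳ; ∈-deduplicate⁺)
open import Data.List.Properties using (filter-++; filter-all; ++-identityʳ; take-all; length-++-≤ˡ)
open import Data.List.Relation.Unary.All as All using (All; []; _∷_)
import Data.List.Relation.Unary.All.Properties as All
open import Data.List.Relation.Unary.Any using (here; there)
open import Data.List.Relation.Unary.Unique.Propositional using (Unique; []; _∷_)
open import Data.List.Relation.Unary.Unique.DecPropositional.Properties using (deduplicate-!)
open import Data.Nat.Base as ℕ using (ℕ; zero; suc; z≤n; s≤s; _<_)
open import Data.Nat.Induction using (<-wellFounded)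
import Data.Nat.Properties as ℕ
open import Data.Product.Base using (∃; ∃₂; _×_; _,_; proj₁; proj₂)
open import Data.Sum.Base using (_⊎_; inj₁; inj₂; [_,_]′)
open import Data.Vec.Base using ([]; _∷_; lookup; here; there)
open import Data.Vec.Properties using ([]=⇒lookup; lookup⇒[]=)
open import Function.Base using (_∘_; id; case_of_)
open import Function.Definitions using (Injective)
open import Induction.WellFounded using (Acc; acc)
open import Level using (Level; _⊔_)
open import Relation.Binary.Bundles using (DecTotalOrder)
open import Relation.Binary.PropositionalEquality.Core
  using (_≡_; _≢_; refl; sym; trans; cong; subst)
open import Relation.Nullary.Decidable.Core using (Dec; yes; no; ¬?; _×-dec_; decidable-stable)
open import Relation.Nullary.Negation.Core using (¬_; contradiction)

private
  variable
    n : ℕ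
    p q : Subset n
    x y : Fin n

-- Subsets: membership and cardinality

x∈p─q⇒x∉q : ∀ (p q : Subset n) → x ∈ p ─ q → x ∉ q
x∈p─q⇒x∉q (_ ∷ p) (inside  ∷ q) (there m) (there k) = x∈p─q⇒x∉q p q m k
x∈p─q⇒x∉q (_ ∷ p) (outside ∷ q) (there m) (there k) = x∈p─q⇒x∉q p q m k

x∉p-x : ∀ (p : Subset n) x → x ∉ p -ˢ x
x∉p-x p x m = x∈p─q⇒x∉q p ⁅ x ⁆ m (x∈⁅x⁆ x)

x∈p∪⁅x⁆ : ∀ (p : Subset n) x → x ∈ p ∪ ⁅ x ⁆
x∈p∪⁅x⁆ p x = q⊆p∪q p ⁅ x ⁆ (x∈⁅x⁆ x)

x∈p∪⁅y⁆⁻ : ∀ (p : Subset n) y → x ∈ p ∪ ⁅ y ⁆ → x ∈ p ⊎ x ≡ y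
x∈p∪⁅y⁆⁻ p y m = [ inj₁ , inj₂ ∘ x∈⁅y⁆⇒x≡y y ]′ (x∈p∪q⁻ p ⁅ y ⁆ m)

∪-least : ∀ {p q r : Subset n} → p ⊆ r → q ⊆ r → p ∪ q ⊆ r
∪-least {p = p} {q} p⊆r q⊆r m = [ p⊆r , q⊆r ]′ (x∈p∪q⁻ p q m)

⁅x⁆⊆p : x ∈ p → ⁅ x ⁆ ⊆ p
⁅x⁆⊆p {x = x} {p = p} x∈p m = subst (_∈ p) (sym (x∈⁅y⁆⇒x≡y x m)) x∈p

∪⁅⁆-⊆ : p ⊆ q → x ∈ q → p ∪ ⁅ x ⁆ ⊆ q
∪⁅⁆-⊆ p⊆q x∈q = ∪-least p⊆q (⁅x⁆⊆p x∈q)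

p-x∪⁅x⁆≡p : x ∈ p → (p -ˢ x) ∪ ⁅ x ⁆ ≡ p
p-x∪⁅x⁆≡p {x = x} {p = p} x∈p = ⊆-antisym (∪⁅⁆-⊆ (p─q⊆p p ⁅ x ⁆) x∈p) back
  where
  back : p ⊆ (p -ˢ x) ∪ ⁅ x ⁆
  back {y} y∈p with y ≟ x
  ... | yes refl = x∈p∪⁅x⁆ (p -ˢ x) x
  ... | no  y≢x  = p⊆p∪q _ (x∈p∧x≢y⇒x∈p-y y∈p y≢x)

p∪⁅x⁆-x≡p : x ∉ p → (p ∪ ⁅ x ⁆) -ˢ x ≡ p
p∪⁅x⁆-x≡p {x = x} {p = p} x∉p = ⊆-antisym there′ back
  where
  there′ : (p ∪ ⁅ x ⁆) -ˢ x ⊆ p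
  there′ m = [ id , (λ { refl → ⊥-elim (x∉p-x (p ∪ ⁅ x ⁆) x m) }) ]′ (x∈p∪⁅y⁆⁻ p x (p─q⊆p _ ⁅ x ⁆ m))
  back : p ⊆ (p ∪ ⁅ x ⁆) -ˢ x
  back y∈p = x∈p∧x≢y⇒x∈p-y (p⊆p∪q _ y∈p) λ { refl → x∉p y∈p }

p∪⁅x⁆─p≡⁅x⁆ : x ∉ p → (p ∪ ⁅ x ⁆) ─ p ≡ ⁅ x ⁆
p∪⁅x⁆─p≡⁅x⁆ {x = x} {p = p} x∉p = ⊆-antisym there′ (⁅x⁆⊆p (x∈p∧x∉q⇒x∈p─q (x∈p∪⁅x⁆ p x) x∉p))
  where
  there′ : (p ∪ ⁅ x ⁆) ─ p ⊆ ⁅ x ⁆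
  there′ m = [ (λ y∈p → ⊥-elim (x∈p─q⇒x∉q _ p m y∈p)) , (λ { refl → x∈⁅x⁆ x }) ]′
             (x∈p∪⁅y⁆⁻ p x (p─q⊆p _ p m))

∣p∪⁅x⁆∣ : ∀ (p : Subset n) → x ∉ p → ∣ p ∪ ⁅ x ⁆ ∣ ≡ suc ∣ p ∣
∣p∪⁅x⁆∣ {x = zero}  (inside  ∷ p) x∉p = contradiction here x∉p
∣p∪⁅x⁆∣ {x = zero}  (outside ∷ p) x∉p = cong (suc ∘ ∣_∣) (∪-identityʳ p)
∣p∪⁅x⁆∣ {x = suc x} (inside  ∷ p) x∉p = cong suc (∣p∪⁅x⁆∣ p (x∉p ∘ there))
∣p∪⁅x⁆∣ {x = suc x} (outside ∷ p) x∉p = ∣p∪⁅x⁆∣ p (x∉p ∘ there)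

∣p∪q∣≤∣p∣+∣q∣ : ∀ (p q : Subset n) → ∣ p ∪ q ∣ ℕ.≤ ∣ p ∣ ℕ.+ ∣ q ∣
∣p∪q∣≤∣p∣+∣q∣ [] [] = z≤n
∣p∪q∣≤∣p∣+∣q∣ (inside  ∷ p) (inside  ∷ q) =
  s≤s (ℕ.≤-trans (∣p∪q∣≤∣p∣+∣q∣ p q) (ℕ.+-monoʳ-≤ ∣ p ∣ (ℕ.n≤1+n ∣ q ∣)))
∣p∪q∣≤∣p∣+∣q∣ (inside  ∷ p) (outside ∷ q) = s≤s (∣p∪q∣≤∣p∣+∣q∣ p q)
∣p∪q∣≤∣p∣+∣q∣ (outside ∷ p) (inside  ∷ q) =
  subst (suc ∣ p ∪ q ∣ ℕ.≤_) (sym (ℕ.+-suc ∣ p ∣ ∣ q ∣)) (s≤s (∣p∪q∣≤∣p∣+∣q∣ p q))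
∣p∪q∣≤∣p∣+∣q∣ (outside ∷ p) (outside ∷ q) = ∣p∪q∣≤∣p∣+∣q∣ p q

∣p∪⁅x⁆∣≤1+∣p∣ : ∀ (p : Subset n) x → ∣ p ∪ ⁅ x ⁆ ∣ ℕ.≤ suc ∣ p ∣
∣p∪⁅x⁆∣≤1+∣p∣ p x = subst (∣ p ∪ ⁅ x ⁆ ∣ ℕ.≤_)
  (trans (cong (∣ p ∣ ℕ.+_) (∣⁅x⁆∣≡1 x)) (ℕ.+-comm ∣ p ∣ 1)) (∣p∪q∣≤∣p∣+∣q∣ p ⁅ x ⁆)

∣p∣≤∣p─q∣+∣q∣ : ∀ (p q : Subset n) → ∣ p ∣ ℕ.≤ ∣ p ─ q ∣ ℕ.+ ∣ q ∣
∣p∣≤∣p─q∣+∣q∣ p q = ℕ.≤-trans (p⊆q⇒∣p∣≤∣q∣ cover) (∣p∪q∣≤∣p∣+∣q∣ (p ─ q) q)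
  where
  cover : p ⊆ (p ─ q) ∪ q
  cover {x} x∈p with x ∈? q
  ... | yes x∈q = q⊆p∪q (p ─ q) q x∈q
  ... | no  x∉q = p⊆p∪q q (x∈p∧x∉q⇒x∈p─q x∈p x∉q)

p⊆q∧∣q∣≤∣p∣⇒q⊆p : p ⊆ q → ∣ q ∣ ℕ.≤ ∣ p ∣ → q ⊆ p
p⊆q∧∣q∣≤∣p∣⇒q⊆p {p = p} p⊆q le {x} x∈q with x ∈? p
... | yes x∈p = x∈p
... | no  x∉p = contradiction (p⊂q⇒∣p∣<∣q∣ (p⊆q , x , x∈q , x∉p)) (ℕ.≤⇒≯ le)

0<∣p∣⇒Nonempty : 0 ℕ.< ∣ p ∣ → Nonempty p
0<∣p∣⇒Nonempty {n} {p} 0<∣p∣ with nonempty? p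
... | yes ne = ne
... | no ¬ne = contradiction (subst (0 ℕ.<_) (trans (cong ∣_∣ (Empty-unique ¬ne)) (∣⊥∣≡0 n)) 0<∣p∣) λ ()

-- Unfolds to the same term as `swap` but lies outside the parameters of `IMD`, so general matroid
-- facts stated with it apply to `swap` directly.
exchange : Subset n → Fin n → Fin n → Subset n
exchange X e e′ = (X -ˢ e) ∪ ⁅ e′ ⁆

x∈exchange⁻ : ∀ (X : Subset n) e e′ → x ∈ exchange X e e′ → (x ∈ X × x ≢ e) ⊎ x ≡ e′
x∈exchange⁻ X e e′ m with x∈p∪⁅y⁆⁻ (X -ˢ e) e′ m
... | inj₁ x∈ = inj₁ (p─q⊆p X ⁅ e ⁆ x∈ , λ { refl → x∉p-x X e x∈ })
... | inj₂ eq = inj₂ eq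

x∈exchange⁺ : ∀ {X : Subset n} {e} e′ → x ∈ X → x ≢ e → x ∈ exchange X e e′
x∈exchange⁺ e′ x∈X x≢e = p⊆p∪q _ (x∈p∧x≢y⇒x∈p-y x∈X x≢e)

∣exchange∣ : ∀ {X : Subset n} {e e′} → e ∈ X → e′ ∉ X → ∣ exchange X e e′ ∣ ≡ ∣ X ∣
∣exchange∣ {X = X} {e} e∈X e′∉X =
  trans (∣p∪⁅x⁆∣ (X -ˢ e) (e′∉X ∘ p─q⊆p X ⁅ e ⁆))
        (trans (sym (∣p∪⁅x⁆∣ (X -ˢ e) (x∉p-x X e))) (cong ∣_∣ (p-x∪⁅x⁆≡p e∈X)))

exchange-exchange : ∀ {X : Subset n} {e e′} d → e′ ∉ X →
                    exchange (exchange X e e′) e′ d ≡ exchange X e d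
exchange-exchange {X = X} {e} d e′∉X = cong (_∪ ⁅ d ⁆) (p∪⁅x⁆-x≡p (e′∉X ∘ p─q⊆p X ⁅ e ⁆))

-- Supplies the decreasing measure for `locallyMin⇒minBasis`.
∣exchange─∣< : ∀ {X Z : Subset n} {e y} → e ∈ Z → e ∉ X → y ∈ X → y ∉ Z →
               ∣ exchange Z e y ─ X ∣ ℕ.< ∣ Z ─ X ∣
∣exchange─∣< {X = X} {Z} {e} {y} e∈Z e∉X y∈X y∉Z =
  p⊂q⇒∣p∣<∣q∣ (closer , e , x∈p∧x∉q⇒x∈p─q e∈Z e∉X , e∉)
  where
  closer : exchange Z e y ─ X ⊆ Z ─ X
  closer m with x∈exchange⁻ Z e y (p─q⊆p _ X m)
  ... | inj₁ (x∈Z , _) = x∈p∧x∉q⇒x∈p─q x∈Z (x∈p─q⇒x∉q _ X m)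
  ... | inj₂ refl      = contradiction y∈X (x∈p─q⇒x∉q _ X m)
  e∉ : e ∉ exchange Z e y ─ X
  e∉ m with x∈exchange⁻ Z e y (p─q⊆p _ X m)
  ... | inj₁ (_ , e≢e) = e≢e refl
  ... | inj₂ refl      = y∉Z e∈Z

-- Bases and symmetric exchange

module MatroidProperties {ℓ} {n} (M : Matroid n ℓ) where
  open Matroid M

  ∣indep∣≤∣basis∣ : ∀ {B I} → IsBasis M B → Indep I → ∣ I ∣ ℕ.≤ ∣ B ∣
  ∣indep∣≤∣basis∣ (i , maximal) j = ℕ.≮⇒≥ λ lt →
    let e , _ , e∉B , k = augment i j lt
    in e∉B (maximal _ k (p⊆p∪q _) (x∈p∪⁅x⁆ _ e))

  largeIndep⇒basis : ∀ {B I} → IsBasis M B → Indep I → ∣ B ∣ ℕ.≤ ∣ I ∣ → IsBasis M I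
  largeIndep⇒basis b i le = i , λ Z j I⊆Z →
    p⊆q∧∣q∣≤∣p∣⇒q⊆p I⊆Z (ℕ.≤-trans (∣indep∣≤∣basis∣ b j) le)

  extend : ∀ {I J} → Indep I → Indep J → ∣ I ∣ ℕ.≤ ∣ J ∣ →
           ∃ λ K → Indep K × I ⊆ K × K ⊆ I ∪ J × ∣ K ∣ ≡ ∣ J ∣
  -- The counter is filled in as `∣ J ∣ ∸ ∣ I ∣`, the number of augmentations to be made.
  extend {J = J} i₀ j le = go _ i₀ (sym (ℕ.m∸n+n≡m le))
    where
    go : ∀ k {I} → Indep I → ∣ J ∣ ≡ k ℕ.+ ∣ I ∣ →
         ∃ λ K → Indep K × I ⊆ K × K ⊆ I ∪ J × ∣ K ∣ ≡ ∣ J ∣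
    go zero    {I} i eq = I , i , id , p⊆p∪q J , sym eq
    go (suc k) {I} i eq with augment i j (subst (suc ∣ I ∣ ℕ.≤_) (sym eq) (s≤s (ℕ.m≤n+m ∣ I ∣ k)))
    ... | e , e∈J , e∉I , i′
      with go k i′ (trans eq (trans (sym (ℕ.+-suc k ∣ I ∣)) (cong (k ℕ.+_) (sym (∣p∪⁅x⁆∣ I e∉I)))))
    ... | K , kᵢ , I′⊆K , K⊆ , eqK =
      K , kᵢ , I′⊆K ∘ p⊆p∪q ⁅ e ⁆
        , ∪-least (∪⁅⁆-⊆ (p⊆p∪q J) (q⊆p∪q I J e∈J)) (q⊆p∪q I J) ∘ K⊆ , eqK

  -- D ∪ ⁅ e ⁆ is a circuit when S is independent.
  minimalDependent : ∀ e S → ¬ Indep (S ∪ ⁅ e ⁆) →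
    ∃ λ D → D ⊆ S × ¬ Indep (D ∪ ⁅ e ⁆) × (∀ y → y ∈ D → Indep (exchange D y e))
  minimalDependent e S = go S (<-wellFounded ∣ S ∣)
    where
    go : ∀ S → Acc ℕ._<_ ∣ S ∣ → ¬ Indep (S ∪ ⁅ e ⁆) →
      ∃ λ D → D ⊆ S × ¬ Indep (D ∪ ⁅ e ⁆) × (∀ y → y ∈ D → Indep (exchange D y e))
    go S (acc rec) dep with any? (λ y → y ∈? S ×-dec ¬? (indep? (exchange S y e)))
    -- `exchange S y e` unfolds to `(S -ˢ y) ∪ ⁅ e ⁆`, so `dep′` is already the hypothesis for the
    -- smaller set.
    ... | yes (y , y∈S , dep′) with go (S -ˢ y) (rec (x∈p⇒∣p-x∣<∣p∣ y∈S)) dep′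
    ...   | D , D⊆ , rest = D , p─q⊆p S ⁅ y ⁆ ∘ D⊆ , rest
    go S _ dep | no minimal = S , id , dep , λ y y∈S →
      decidable-stable (indep? _) λ dep′ → minimal (y , y∈S , dep′)

  -- y is found on the circuit of e in Y ∪ ⁅ e ⁆: that circuit is not spanned by Z -ˢ e.
  symmetricExchange : ∀ {Y Z e} → IsBasis M Y → IsBasis M Z → e ∈ Z → e ∉ Y →
    ∃ λ y → y ∈ Y × y ∉ Z × IsBasis M (exchange Y y e) × IsBasis M (exchange Z e y)
  symmetricExchange {Y} {Z} {e} bY@(iY , maxY) bZ@(iZ , _) e∈Z e∉Y =
    conclude (minimalDependent e Y λ i → e∉Y (maxY _ i (p⊆p∪q _) (x∈p∪⁅x⁆ Y e)))
    where
    Z⁻ = Z -ˢ e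

    iZ⁻ : Indep Z⁻
    iZ⁻ = hereditary (p─q⊆p Z ⁅ e ⁆) iZ

    ∣Z⁻∣<∣Z∣ : ∣ Z⁻ ∣ ℕ.< ∣ Z ∣
    ∣Z⁻∣<∣Z∣ = x∈p⇒∣p-x∣<∣p∣ e∈Z

    Step : Subset n → Set _
    Step D = ∃ λ y → y ∈ D × y ∉ Z⁻ × Indep (Z⁻ ∪ ⁅ y ⁆)

    -- If `Z⁻` spanned all of `D`, it would also span `e`, against the independence of `Z`. In terms
    -- of cardinalities, unless `D` is larger than `Z⁻`: pad `D` from `Z⁻` to a set `K` of size
    -- `∣ Z⁻ ∣`, enlarge `K` by some `z` of `Z`, and augment `Z⁻` from the result.
    leaves : ∀ {D} → D ⊆ Y → ¬ Indep (D ∪ ⁅ e ⁆) → Step D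
    leaves {D} D⊆Y dep with ∣ D ∣ ℕ.≤? ∣ Z⁻ ∣
    ... | no ≰ = augment iZ⁻ (hereditary D⊆Y iY) (ℕ.≰⇒> ≰)
    ... | yes le with extend (hereditary D⊆Y iY) iZ⁻ le
    ...   | K , iK , D⊆K , K⊆ , ∣K∣≡
      with augment iK iZ (subst (ℕ._< ∣ Z ∣) (sym ∣K∣≡) ∣Z⁻∣<∣Z∣)
    ...     | z , z∈Z , z∉K , iKz
      with z ≟ e
    ...       | yes refl = contradiction (hereditary (∪⁅⁆-⊆ (p⊆p∪q _ ∘ D⊆K) (x∈p∪⁅x⁆ K e)) iKz) dep
    ...       | no  z≢e
      with augment iZ⁻ iKz (subst (∣ Z⁻ ∣ ℕ.<_) (sym (trans (∣p∪⁅x⁆∣ K z∉K) (cong suc ∣K∣≡))) (ℕ.n<1+n _))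
    ...         | y , y∈ , y∉Z⁻ , i = y , y∈D , y∉Z⁻ , i
      where
      -- `y` avoids `Z⁻`, which contains both `z` and the padding of `K`; only `D` is left.
      y∈D : y ∈ D
      y∈D with x∈p∪⁅y⁆⁻ K z y∈
      ... | inj₂ refl = contradiction (x∈p∧x≢y⇒x∈p-y z∈Z z≢e) y∉Z⁻
      ... | inj₁ y∈K with x∈p∪q⁻ D Z⁻ (K⊆ y∈K)
      ...   | inj₁ y∈D  = y∈D
      ...   | inj₂ y∈Z⁻ = contradiction y∈Z⁻ y∉Z⁻

    conclude : (∃ λ D → D ⊆ Y × ¬ Indep (D ∪ ⁅ e ⁆) × (∀ y → y ∈ D → Indep (exchange D y e))) →
      ∃ λ y → y ∈ Y × y ∉ Z × IsBasis M (exchange Y y e) × IsBasis M (exchange Z e y)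
    conclude (D , D⊆Y , dep , minimal) with leaves D⊆Y dep
    ... | y , y∈D , y∉Z⁻ , i = y , y∈Y , y∉Z , basisY , basisZ
      where
      y∈Y = D⊆Y y∈D

      y∉Z : y ∉ Z
      y∉Z y∈Z = y∉Z⁻ (x∈p∧x≢y⇒x∈p-y y∈Z λ { refl → e∉Y y∈Y })

      basisZ : IsBasis M (exchange Z e y)
      basisZ = largeIndep⇒basis bZ i (ℕ.≤-reflexive (sym (∣exchange∣ e∈Z y∉Z)))

      ∣D′∣≤∣Y∣ : ∣ exchange D y e ∣ ℕ.≤ ∣ Y ∣
      ∣D′∣≤∣Y∣ = subst (ℕ._≤ ∣ Y ∣) (sym (∣exchange∣ y∈D (e∉Y ∘ D⊆Y))) (p⊆q⇒∣p∣≤∣q∣ D⊆Y)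

      -- Minimality makes `exchange D y e` independent. Filling it up from `Y` cannot bring `y`
      -- back, as that would complete the dependent set `D ∪ ⁅ e ⁆`. Hence the result `K` lies in
      -- `exchange Y y e`, and equal size makes the two coincide.
      basisY : IsBasis M (exchange Y y e)
      basisY with extend (minimal y y∈D) iY ∣D′∣≤∣Y∣
      ... | K , iK , D′⊆K , K⊆ , ∣K∣≡ =
        largeIndep⇒basis bY (hereditary ex⊆K iK) (ℕ.≤-reflexive (sym ∣ex∣))
        where
        ∣ex∣ = ∣exchange∣ y∈Y e∉Y

        y∉K : y ∉ K
        y∉K y∈K = dep (hereditary
          (∪⁅⁆-⊆ D⊆K (D′⊆K (x∈p∪⁅x⁆ _ e))) iK)
          where
          D⊆K : D ⊆ K
          D⊆K {x} x∈D with x ≟ y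
          ... | yes refl = y∈K
          ... | no  x≢y  = D′⊆K (x∈exchange⁺ e x∈D x≢y)

        K⊆ex : K ⊆ exchange Y y e
        K⊆ex {x} x∈K with x∈p∪q⁻ (exchange D y e) Y (K⊆ x∈K)
        ... | inj₂ x∈Y = x∈exchange⁺ e x∈Y λ { refl → y∉K x∈K }
        ... | inj₁ x∈D′ with x∈exchange⁻ D y e x∈D′
        ...   | inj₁ (x∈D , x≢y) = x∈exchange⁺ e (D⊆Y x∈D) x≢y
        ...   | inj₂ refl        = x∈p∪⁅x⁆ _ e

        ex⊆K : exchange Y y e ⊆ K
        ex⊆K = p⊆q∧∣q∣≤∣p∣⇒q⊆p K⊆ex (ℕ.≤-reflexive (trans ∣ex∣ (sym ∣K∣≡)))

-- Arithmetic and order of the weights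

module OrderedGroupProperties {c ℓ₁ ℓ₂} (W : OrderedAbelianGroup c ℓ₁ ℓ₂) where
  open OrderedAbelianGroup W
  open AbelianGroup abelianGroup public
    using (commutativeSemigroup; commutativeMonoid; monoid; group; ∙-congˡ; ∙-congʳ; identityˡ; identityʳ; inverseʳ; assoc; comm)
    renaming (refl to ≈-refl; sym to ≈-sym; trans to ≈-trans)
  open CommutativeSemigroupProperties commutativeSemigroup public using (x∙yz≈y∙xz)
  open GroupProperties group public using (//-rightDividesˡ; //-rightDividesʳ; x∙y⁻¹≈ε⇒x≈y)
  open DecTotalOrder decTotalOrder public using (_≤?_; antisym; totalOrder)
    renaming (refl to ≤-refl; reflexive to ≤-reflexive; trans to ≤-trans)
  open Mult monoid public using () renaming (_×_ to _·_)

  +-monoˡ-≤ : ∀ x {y z} → y ≤ z → y + x ≤ z + x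
  +-monoˡ-≤ x {y} {z} le =
    ≤-trans (≤-reflexive (comm y x)) (≤-trans (+-monoʳ-≤ x le) (≤-reflexive (comm x z)))

  +-mono-≤ : ∀ {x y u v} → x ≤ y → u ≤ v → x + u ≤ y + v
  +-mono-≤ {y = y} {u} le le′ = ≤-trans (+-monoˡ-≤ u le) (+-monoʳ-≤ y le′)

  x≤z+y⇒x-y≤z : ∀ {x y z} → x ≤ z + y → x - y ≤ z
  x≤z+y⇒x-y≤z {y = y} {z} le = ≤-trans (+-monoˡ-≤ (- y) le) (≤-reflexive (//-rightDividesʳ y z))

  x-y≤z⇒x≤z+y : ∀ {x y z} → x - y ≤ z → x ≤ z + y
  x-y≤z⇒x≤z+y {x} {y} le = ≤-trans (≤-reflexive (≈-sym (//-rightDividesˡ y x))) (+-monoˡ-≤ y le)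

  +-cancelʳ-≤ : ∀ x {y z} → y + x ≤ z + x → y ≤ z
  +-cancelʳ-≤ x {y} le = ≤-trans (≤-reflexive (≈-sym (//-rightDividesʳ x y))) (x≤z+y⇒x-y≤z le)

  x≤y⇒x-y≤0 : ∀ {x y} → x ≤ y → x - y ≤ 0#
  x≤y⇒x-y≤0 {y = y} le = x≤z+y⇒x-y≤z (≤-trans le (≤-reflexive (≈-sym (identityˡ y))))

  x≤y⇒0≤y-x : ∀ {x y} → x ≤ y → 0# ≤ y - x
  x≤y⇒0≤y-x {x} le = ≤-trans (≤-reflexive (≈-sym (inverseʳ x))) (+-monoˡ-≤ (- x) le)

  ·-monoˡ-≤ : ∀ {x} → 0# ≤ x → ∀ {j k} → j ℕ.≤ k → j · x ≤ k · x
  ·-monoˡ-≤ 0≤x {k = zero}  z≤n = ≤-refl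
  ·-monoˡ-≤ {x} 0≤x {k = suc k} z≤n =
    ≤-trans (≤-reflexive (≈-sym (identityˡ 0#))) (+-mono-≤ 0≤x (·-monoˡ-≤ 0≤x {0} {k} z≤n))
  ·-monoˡ-≤ {x} 0≤x (s≤s le) = +-monoʳ-≤ x (·-monoˡ-≤ 0≤x le)

  sum-mono-≤ : ∀ {n} {g h : Fin n → Carrier} → (∀ i → g i ≤ h i) → sum g ≤ sum h
  sum-mono-≤ {zero}  le = ≤-refl
  sum-mono-≤ {suc n} le = +-mono-≤ (le zero) (sum-mono-≤ (le ∘ suc))

  open Extrema totalOrder

  upperBound : ∀ {n} (g : Fin n → Carrier) → ∃ λ b → 0# ≤ b × (∀ i → g i ≤ b)
  -- Starting the maximum at `0#` makes the bound nonnegative and covers the empty family.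
  upperBound g = max 0# (tabulate g) , ⊥≤max 0# (tabulate g) , All.tabulate⁻ (xs≤max 0# (tabulate g))

  maximalPair : ∀ {n p} (g : Fin n → Fin n → Carrier) {P : Fin n → Fin n → Set p} →
    (∀ i j → Dec (P i j)) → ∃₂ P → ∃₂ λ i j → P i j × (∀ k l → P k l → g k l ≤ g i j)
  maximalPair {n} g {P} P? (i₀ , j₀ , Pij₀) =
    -- The given pair is the default value of `argmax`; it satisfies `P`, as do all filtered
    -- candidates, and hence so does the maximiser.
    _ , _ , argmax-all g′ {P = λ ij → P (proj₁ ij) (proj₂ ij)} Pij₀ (All.all-filter P?′ pairs) ,
    λ k l Pkl → All.lookup (f[xs]≤f[argmax] {f = g′} (i₀ , j₀) candidates)
      (∈-filter⁺ P?′ (∈-cartesianProduct⁺ (∈-allFin k) (∈-allFin l)) Pkl)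
    where
    g′ : Fin n × Fin n → Carrier
    g′ (i , j) = g i j
    P?′ : ∀ ij → Dec (P (proj₁ ij) (proj₂ ij))
    P?′ (i , j) = P? i j
    pairs = cartesianProduct (allFin n) (allFin n)
    candidates = filter P?′ pairs

-- Minimum weight bases and penalised weights

module WeightedMatroid {c ℓ₁ ℓ₂} (W : OrderedAbelianGroup c ℓ₁ ℓ₂) where
  open OrderedAbelianGroup W
  open OrderedGroupProperties W
  open Minimum W
  open Sum commutativeMonoid using (∑-distrib-+; sum-cong-≋)

  masked : (Fin n → Carrier) → Subset n → Fin n → Carrier
  masked v X e = if lookup X e then v e else 0#

  -- The weight function is an argument so that the same lemmas serve `w` and its penalised
  -- versions; at `w` this unfolds to `weight`.
  total-weight : (Fin n → Carrier) → Subset n → Carrier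
  total-weight v X = sum (masked v X)

  total-∪⁅⁆ : ∀ (v : Fin n → Carrier) (X : Subset n) e → e ∉ X →
              total-weight v (X ∪ ⁅ e ⁆) ≈ v e + total-weight v X
  total-∪⁅⁆ v (inside  ∷ X) zero e∉X = contradiction here e∉X
  total-∪⁅⁆ v (outside ∷ X) zero e∉X rewrite ∪-identityʳ X = ∙-congˡ (≈-sym (identityˡ _))
  total-∪⁅⁆ v (inside  ∷ X) (suc e) e∉X =
    ≈-trans (∙-congˡ (total-∪⁅⁆ (v ∘ suc) X e (e∉X ∘ there))) (x∙yz≈y∙xz _ _ _)
  total-∪⁅⁆ v (outside ∷ X) (suc e) e∉X =
    ≈-trans (∙-congˡ (total-∪⁅⁆ (v ∘ suc) X e (e∉X ∘ there))) (x∙yz≈y∙xz _ _ _)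

  total-exchange : ∀ (v : Fin n → Carrier) {X e e′} → e ∈ X → e′ ∉ X →
                   total-weight v (exchange X e e′) + v e ≈ total-weight v X + v e′
  total-exchange v {X} {e} {e′} e∈X e′∉X =
    ≈-trans (∙-congʳ (≈-trans (total-∪⁅⁆ v (X -ˢ e) e′ (e′∉X ∘ p─q⊆p X ⁅ e ⁆)) (comm _ _)))
    (≈-trans (assoc _ _ _) (≈-trans (∙-congˡ (comm _ _)) (≈-trans (≈-sym (assoc _ _ _))
    (∙-congʳ (≈-trans (comm _ _) split)))))
    where
    split : v e + total-weight v (X -ˢ e) ≈ total-weight v X
    split = ≈-sym (subst (λ Z → total-weight v Z ≈ v e + total-weight v (X -ˢ e))
                         (p-x∪⁅x⁆≡p e∈X) (total-∪⁅⁆ v (X -ˢ e) e (x∉p-x X e)))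

  exchange-≤ : ∀ (v : Fin n → Carrier) {X e e′} → e ∈ X → e′ ∉ X →
    v e′ ≤ v e → total-weight v (exchange X e e′) ≤ total-weight v X
  exchange-≤ v {X} {e} {e′} e∈X e′∉X le = +-cancelʳ-≤ (v e)
    (≤-trans (≤-reflexive (total-exchange v e∈X e′∉X)) (+-monoʳ-≤ (total-weight v X) le))

  exchange-≤⁻ : ∀ (v : Fin n → Carrier) {X e e′} → e ∈ X → e′ ∉ X →
    total-weight v X ≤ total-weight v (exchange X e e′) → v e ≤ v e′
  exchange-≤⁻ v {X} {e} {e′} e∈X e′∉X le = +-cancelʳ-≤ (total-weight v X)
    (≤-trans (+-monoʳ-≤ (v e) le) (≤-trans (≤-reflexive (comm _ _))
    (≤-trans (≤-reflexive (total-exchange v e∈X e′∉X)) (≤-reflexive (comm _ _)))))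

  module _ {ℓ} {n} (M : Matroid n ℓ) where
    open MatroidProperties M

    MinBasis : (Fin n → Carrier) → Subset n → Set _
    MinBasis v = IsMinimiser (total-weight v) (IsBasis M)

    LocallyMin : (Fin n → Carrier) → Subset n → Set _
    LocallyMin v X = ∀ {e e′} → e ∈ X → e′ ∉ X → IsBasis M (exchange X e e′) → v e ≤ v e′

    minBasis⇒locallyMin : ∀ {v X} → MinBasis v X → LocallyMin v X
    minBasis⇒locallyMin {v} (_ , least) e∈X e′∉X b = exchange-≤⁻ v e∈X e′∉X (least _ b)

    -- Any basis `Z` can be moved to `X` without gaining weight: symmetric exchange pairs some `e`
    -- of `Z ─ X` with a `y` of `X`, local minimality of `X` gives `v y ≤ v e`, and so
    -- `exchange Z e y` is no heavier and closer to `X`.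
    locallyMin⇒minBasis : ∀ {v X} → IsBasis M X → LocallyMin v X → MinBasis v X
    locallyMin⇒minBasis {v} {X} bX local = bX , λ Z bZ → go Z bZ (<-wellFounded ∣ Z ─ X ∣)
      where
      go : ∀ Z → IsBasis M Z → Acc ℕ._<_ ∣ Z ─ X ∣ → total-weight v X ≤ total-weight v Z
      go Z bZ@(iZ , maxZ) (acc rec) with nonempty? (Z ─ X)
      ... | no empty = ≤-reflexive (subst (λ Z → total-weight v X ≈ total-weight v Z) X≡Z ≈-refl)
        where
        Z⊆X : Z ⊆ X
        Z⊆X {x} x∈Z = decidable-stable (x ∈? X) λ x∉X → empty (x , x∈p∧x∉q⇒x∈p─q x∈Z x∉X)
        X≡Z : X ≡ Z
        X≡Z = ⊆-antisym (maxZ X (proj₁ bX) Z⊆X) Z⊆X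
      ... | yes (e , e∈Z─X) =
        let e∈Z = p─q⊆p Z X e∈Z─X
            e∉X = x∈p─q⇒x∉q Z X e∈Z─X
            y , y∈X , y∉Z , bX′ , bZ′ = symmetricExchange bX bZ e∈Z e∉X
        in ≤-trans (go (exchange Z e y) bZ′ (rec (∣exchange─∣< e∈Z e∉X y∈X y∉Z)))
                   (exchange-≤ v e∈Z y∉Z (local y∈X e∉X bX′))

    -- Restricting the entering elements to Y loses no gain.
    exchangeWithin : ∀ {v X Y e e′} → MinBasis v Y → e ∈ X → e′ ∉ X → IsBasis M (exchange X e e′) →
      v e ≤ v e′ ⊎ ∃ λ y → y ∈ Y × y ∉ X × IsBasis M (exchange X e y) × v y ≤ v e′
    exchangeWithin {v} {X} {Y} {e} {e′} minY@(bY , _) e∈X e′∉X b with e′ ∈? Y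
    ... | yes e′∈Y = inj₂ (e′ , e′∈Y , e′∉X , b , ≤-refl)
    ... | no  e′∉Y =
      -- Symmetric exchange at `e′` between `Y` and the exchanged basis: the `Y` side compares the
      -- weights of `y` and `e′`, and the other side shows that `y` can enter in place of `e′`.
      let y , y∈Y , y∉Z , bY′ , bZ′ = symmetricExchange bY b (x∈p∪⁅x⁆ _ e′) e′∉Y
          le = minBasis⇒locallyMin {v} minY y∈Y e′∉Y bY′
      in case (y ≟ e) of λ
        -- The partner found is the element that left `X`, so the weight comparison itself rules out
        -- a gain.
        { (yes y≡e) → inj₁ (subst (λ d → v d ≤ v e′) y≡e le)
        ; (no  y≢e) → inj₂ (y , y∈Y , (λ y∈X → y∉Z (x∈exchange⁺ e′ y∈X y≢e))
                               , subst (IsBasis M) (exchange-exchange y e′∉X) bZ′ , le)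
        }

  -- Defined through `lookup` so that it computes along the vector in the induction of
  -- `total-penalty`.
  penalty : Subset n → Carrier → Fin n → Carrier
  penalty E θ e = if lookup E e then 0# else θ

  penalised : (Fin n → Carrier) → Subset n → Carrier → Fin n → Carrier
  penalised v E θ e = v e + penalty E θ e

  penalty-∈ : ∀ {E : Subset n} {θ e} → e ∈ E → penalty E θ e ≡ 0#
  penalty-∈ {θ = θ} e∈E = cong (if_then 0# else θ) ([]=⇒lookup e∈E)

  penalty-∉ : ∀ {E : Subset n} {θ e} → e ∉ E → penalty E θ e ≡ θ
  penalty-∉ {E = E} {e = e} e∉E with lookup E e in eq
  ... | true  = contradiction (lookup⇒[]= e E eq) e∉E
  ... | false = refl

  total-penalty : ∀ (E X : Subset n) θ → total-weight (penalty E θ) X ≈ ∣ X ─ E ∣ · θ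
  total-penalty [] [] θ = ≈-refl
  total-penalty (inside  ∷ E) (inside  ∷ X) θ = ≈-trans (identityˡ _) (total-penalty E X θ)
  total-penalty (outside ∷ E) (inside  ∷ X) θ = ∙-congˡ (total-penalty E X θ)
  total-penalty (inside  ∷ E) (outside ∷ X) θ = ≈-trans (identityˡ _) (total-penalty E X θ)
  total-penalty (outside ∷ E) (outside ∷ X) θ = ≈-trans (identityˡ _) (total-penalty E X θ)

  -- The penalised weight is the Lagrangian of minimising `v` under a bound on the number of
  -- elements outside `E`.
  total-penalised : ∀ (v : Fin n → Carrier) (E X : Subset n) θ →
    total-weight (penalised v E θ) X ≈ total-weight v X + ∣ X ─ E ∣ · θ
  total-penalised v E X θ =
    ≈-trans (sum-cong-≋ split) (≈-trans (∑-distrib-+ (masked v X) (masked (penalty E θ) X)) (∙-congˡ (total-penalty E X θ)))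
    where
    split : ∀ e → masked (penalised v E θ) X e ≈ masked v X e + masked (penalty E θ) X e
    split e with lookup X e
    ... | true  = ≈-refl
    ... | false = ≈-sym (identityˡ 0#)

-- Set differences after an exchange

exchange-─ : ∀ {X E : Subset n} {e e′} → e ∈ E → e′ ∉ E → exchange X e e′ ─ E ≡ (X ─ E) ∪ ⁅ e′ ⁆
exchange-─ {X = X} {E} {e} {e′} e∈E e′∉E = ⊆-antisym forth (∪⁅⁆-⊆ back (x∈p∧x∉q⇒x∈p─q (x∈p∪⁅x⁆ _ e′) e′∉E))
  where
  forth : exchange X e e′ ─ E ⊆ (X ─ E) ∪ ⁅ e′ ⁆
  forth m with x∈exchange⁻ X e e′ (p─q⊆p _ E m)
  ... | inj₁ (x∈X , _) = p⊆p∪q _ (x∈p∧x∉q⇒x∈p─q x∈X (x∈p─q⇒x∉q _ E m))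
  ... | inj₂ refl      = x∈p∪⁅x⁆ _ e′
  back : X ─ E ⊆ exchange X e e′ ─ E
  back m = x∈p∧x∉q⇒x∈p─q (x∈exchange⁺ e′ (p─q⊆p X E m) λ { refl → x∈p─q⇒x∉q X E m e∈E }) (x∈p─q⇒x∉q X E m)

-- Only `e′` enters, so an iteration uses up at most one element of `Y ─ X`; `neverStuck` rests on
-- this.
∣Y─X∣≤1+∣Y─exchange∣ : ∀ (Y X : Subset n) e e′ → ∣ Y ─ X ∣ ℕ.≤ suc ∣ Y ─ exchange X e e′ ∣
∣Y─X∣≤1+∣Y─exchange∣ Y X e e′ = ℕ.≤-trans (p⊆q⇒∣p∣≤∣q∣ cover) (∣p∪⁅x⁆∣≤1+∣p∣ (Y ─ exchange X e e′) e′)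
  where
  cover : Y ─ X ⊆ (Y ─ exchange X e e′) ∪ ⁅ e′ ⁆
  cover {x} m with x ≟ e′
  ... | yes refl = x∈p∪⁅x⁆ _ e′
  ... | no  x≢e′ = p⊆p∪q _ (x∈p∧x∉q⇒x∈p─q (p─q⊆p Y X m) λ k →
    [ (λ (x∈X , _) → x∈p─q⇒x∉q Y X m x∈X) , x≢e′ ]′ (x∈exchange⁻ X e e′ k))

-- Certificates and the run of the greedy algorithm

module GreedyRun
  {c ℓ₁ ℓ₂ ℓ : Level} (W : OrderedAbelianGroup c ℓ₁ ℓ₂)
  {n : ℕ} (M : Matroid n ℓ)
  (w : Fin n → OrderedAbelianGroup.Carrier W)
  (E₀ : Subset n)
  (spanning : ∃ λ B → IsBasis M B × B ⊆ E₀)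
  where

  open OrderedAbelianGroup W
  open OrderedGroupProperties W
  open WeightedMatroid W
  open MatroidProperties M
  open Matroid M using (augment)
  open IMD W M w E₀ spanning

  f≤weight : ∀ {A X} → IsBasis M X → X ⊆ E₀ ∪ A → f A ≤ weight X
  f≤weight {A} bX X⊆ = proj₂ (proj₂ (best A)) _ (bX , X⊆)

  penalty≥0 : ∀ {θ} e → 0# ≤ θ → 0# ≤ penalty E₀ θ e
  penalty≥0 e 0≤θ with lookup E₀ e
  ... | true  = ≤-refl
  ... | false = 0≤θ

  x+0≤y : ∀ {x y} → x ≤ y → x + 0# ≤ y
  x+0≤y le = ≤-trans (≤-reflexive (identityʳ _)) le

  x≤y+0 : ∀ {x y} → x ≤ y → x ≤ y + 0#
  x≤y+0 le = ≤-trans le (≤-reflexive (≈-sym (identityʳ _)))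

  x≤x+y : ∀ {x y} → 0# ≤ y → x ≤ x + y
  x≤x+y {x} 0≤y = ≤-trans (≤-reflexive (≈-sym (identityʳ x))) (+-monoʳ-≤ x 0≤y)

  -- Used to put values in place of penalties and back, as `penalty` does not reduce at an unknown
  -- element.
  subst-+≤+ : ∀ {x y a a′ b b′} → a ≡ a′ → b ≡ b′ → x + a ≤ y + b → x + a′ ≤ y + b′
  subst-+≤+ refl refl le = le

  -- θ is a Lagrange multiplier for the number of elements outside E₀.
  record Certificate (A X : Subset n) : Set (c ⊔ ℓ₂ ⊔ ℓ) where
    field
      θ        : Carrier
      0≤θ      : 0# ≤ θ
      minBasis : MinBasis M (penalised w E₀ θ) X
      outside≡ : X ─ E₀ ≡ A

    basis : IsBasis M X
    basis = proj₁ minBasis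

    X⊆E₀∪A : X ⊆ E₀ ∪ A
    X⊆E₀∪A {x} x∈X with x ∈? E₀
    ... | yes x∈E₀ = p⊆p∪q A x∈E₀
    ... | no  x∉E₀ = q⊆p∪q E₀ A (subst (x ∈_) outside≡ (x∈p∧x∉q⇒x∈p─q x∈X x∉E₀))

    -- Compare the Lagrangians of `X` and `Z`: the fee paid by `Z` is at most that paid by `X`,
    -- because `0# ≤ θ`, and then the fee cancels.
    weight-least : ∀ Z → IsBasis M Z → ∣ Z ─ E₀ ∣ ℕ.≤ ∣ A ∣ → weight X ≤ weight Z
    weight-least Z bZ le = +-cancelʳ-≤ (∣ X ─ E₀ ∣ · θ)
      (≤-trans (≤-reflexive (≈-sym (total-penalised w E₀ X θ)))
      (≤-trans (proj₂ minBasis Z bZ)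
      (≤-trans (≤-reflexive (total-penalised w E₀ Z θ))
      (+-monoʳ-≤ (weight Z) (·-monoˡ-≤ 0≤θ (subst (λ A → _ ℕ.≤ ∣ A ∣) (sym outside≡) le))))))

    f-least : ∀ Z → IsBasis M Z → ∣ Z ─ E₀ ∣ ℕ.≤ ∣ A ∣ → f A ≤ weight Z
    f-least Z bZ le = ≤-trans (f≤weight basis X⊆E₀∪A) (weight-least Z bZ le)

  basis-restrict⁺ : ∀ {X} → IsBasis M X → X ⊆ E₀ → IsBasis (restrict M E₀) X
  basis-restrict⁺ (i , maximal) X⊆ = (i , X⊆) , λ Z (j , _) → maximal Z j

  -- If `X` were smaller than the basis inside `E₀`, it could be augmented from there without
  -- leaving `E₀`.
  basis-restrict⁻ : ∀ {X} → IsBasis (restrict M E₀) X → IsBasis M X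
  basis-restrict⁻ {X} ((i , X⊆) , maximal) =
    let B , bB , B⊆ = spanning
    in largeIndep⇒basis bB i (ℕ.≮⇒≥ λ lt →
         let e , e∈B , e∉X , j = augment i (proj₁ bB) lt
         in e∉X (maximal _ (j , ∪⁅⁆-⊆ X⊆ (B⊆ e∈B)) (p⊆p∪q _) (x∈p∪⁅x⁆ X e)))

  initialCertificate : ∀ {X} → IsMinWeightBasis (restrict M E₀) X → Certificate ⊥ X
  initialCertificate {X} (bX , least) = record
    { θ        = θ
    ; 0≤θ      = 0≤θ
    ; minBasis = locallyMin⇒minBasis M bX′ local
    ; outside≡ = Empty-unique λ (x , m) → x∈p─q⇒x∉q X E₀ m (X⊆E₀ (p─q⊆p X E₀ m))
    }
    where
    bX′ = basis-restrict⁻ bX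
    X⊆E₀ = proj₂ (proj₁ bX)
    -- `a` bounds the weights and `b` their negatives, so `θ` dominates every difference of two
    -- weights and no exchange that leaves `E₀` pays.
    a = proj₁ (upperBound w)
    b = proj₁ (upperBound (-_ ∘ w))
    θ = b + a
    0≤θ = ≤-trans (proj₁ (proj₂ (upperBound (-_ ∘ w)))) (x≤x+y (proj₁ (proj₂ (upperBound w))))

    difference≤θ : ∀ e e′ → w e ≤ w e′ + θ
    difference≤θ e e′ =
      ≤-trans (≤-reflexive (≈-sym (identityˡ (w e))))
      (≤-trans (+-mono-≤ (≤-trans (≤-reflexive (≈-sym (inverseʳ (w e′))))
                                  (+-monoʳ-≤ (w e′) (proj₂ (proj₂ (upperBound (-_ ∘ w))) e′)))
                         (proj₂ (proj₂ (upperBound w)) e))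
      (≤-reflexive (assoc _ _ _)))

    local : LocallyMin M (penalised w E₀ θ) X
    local {e} {e′} e∈X e′∉X bE with e′ ∈? E₀
    ... | yes e′∈E₀ = subst-+≤+ (sym (penalty-∈ (X⊆E₀ e∈X))) (sym (penalty-∈ e′∈E₀))
      (+-monoˡ-≤ 0# (exchange-≤⁻ w e∈X e′∉X (least _ (basis-restrict⁺ bE
        (∪⁅⁆-⊆ (X⊆E₀ ∘ p─q⊆p X ⁅ e ⁆) e′∈E₀)))))
    ... | no  e′∉E₀ = subst-+≤+ (sym (penalty-∈ (X⊆E₀ e∈X))) (sym (penalty-∉ e′∉E₀))
      (x+0≤y (difference≤θ e e′))

  -- The prefix of the output recorded with positive gain; after it f has its minimum.
  data Greedy (A : Subset n) : List (Fin n) → Set (c ⊔ ℓ₂ ⊔ ℓ) where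
    stop : (∀ Z → IsBasis M Z → f A ≤ weight Z) → Greedy A []
    next : ∀ {e es} → e ∉ E₀ ∪ A →
           (∀ Z → IsBasis M Z → ∣ Z ─ E₀ ∣ ℕ.≤ ∣ A ∣ → f A ≤ weight Z) →
           Greedy (A ∪ ⁅ e ⁆) es → Greedy A (e ∷ es)

  module _ {Y} (minY : IsMinWeightBasis M Y) where

    -- Symmetric exchange also yields the mirrored exchange in `Y`, which cannot lower the weight
    -- because `Y` is minimal.
    exchangePair : ∀ {X e′} → IsBasis M X → e′ ∈ Y ─ X →
                   ∃ λ e → ExchangePairFor X Y e e′ × w e′ ≤ w e
    exchangePair {X} {e′} bX e′∈Y─X =
      let e′∈Y = p─q⊆p Y X e′∈Y─X
          e′∉X = x∈p─q⇒x∉q Y X e′∈Y─X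
          e , e∈X , e∉Y , bX′ , bY′ = symmetricExchange bX (proj₁ minY) e′∈Y e′∉X
      in e , ((e∈X , e′∉X , bX′) , e′∈Y─X) , minBasis⇒locallyMin M minY e′∈Y e∉Y bY′

    optimalPair : ∀ {X} → IsBasis M X → 0 ℕ.< ∣ Y ─ X ∣ → ∃₂ (OptimalExchangePair X Y)
    optimalPair {X} bX lt =
      let e′ , e′∈Y─X = 0<∣p∣⇒Nonempty lt
          e , pair , _ = exchangePair bX e′∈Y─X
      in maximalPair (λ d d′ → w d - w d′)
           (λ d d′ → (d ∈? X ×-dec ¬? (d′ ∈? X) ×-dec isBasis? M (swap X d d′)) ×-dec d′ ∈? (Y ─ X))
           (e , e′ , pair)

    steps-progress : ∀ {X es X′} → Steps Y X es X′ → IsBasis M X →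
                     IsBasis M X′ × ∣ Y ─ X ∣ ℕ.≤ length es ℕ.+ ∣ Y ─ X′ ∣
    steps-progress done bX = bX , ℕ.≤-refl
    steps-progress {X} (step {e = e} {e′} opt@(((_ , _ , bX′) , _) , _) steps) _ =
      let bX″ , le = steps-progress steps bX′
      in bX″ , ℕ.≤-trans (∣Y─X∣≤1+∣Y─exchange∣ Y X e e′) (s≤s le)

    gain≥0 : ∀ {X e e′} → IsBasis M X → OptimalExchangePair X Y e e′ → 0# ≤ w e - w e′
    gain≥0 {e′ = e′} bX ((_ , e′∈Y─X) , greatest) =
      let d , pair , le = exchangePair bX e′∈Y─X
      in ≤-trans (x≤y⇒0≤y-x le) (greatest d e′ pair)

    -- Optimality of the pair only concerns elements entering from `Y`; `exchangeWithin` carries the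
    -- bound over to every exchange of `X`.
    gain-bound : ∀ {X e e′ d d′} → OptimalExchangePair X Y e e′ →
      d ∈ X → d′ ∉ X → IsBasis M (swap X d d′) →
      w d ≤ w d′ ⊎ w d ≤ w e - w e′ + w d′
    gain-bound {d = d} (_ , greatest) d∈X d′∉X b with exchangeWithin M minY d∈X d′∉X b
    ... | inj₁ le = inj₁ le
    ... | inj₂ (y , y∈Y , y∉X , b′ , le) = inj₂
      (≤-trans (x-y≤z⇒x≤z+y (greatest d y ((d∈X , y∉X , b′) , x∈p∧x∉q⇒x∈p─q y∈Y y∉X)))
               (+-monoʳ-≤ _ le))

    -- Both alternatives of `gain-bound` now say that no exchange lowers the weight, and local
    -- minimality is global.
    noGain⇒minBasis : ∀ {X e e′} → IsBasis M X → OptimalExchangePair X Y e e′ →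
                      w e - w e′ ≤ 0# → MinBasis M w X
    noGain⇒minBasis bX opt noGain = locallyMin⇒minBasis M bX λ d∈X d′∉X b →
      [ id , (λ le → ≤-trans le (≤-trans (+-monoˡ-≤ _ noGain) (≤-reflexive (identityˡ _)))) ]′
      (gain-bound opt d∈X d′∉X b)

    -- A positive gain forces e ∈ E₀ and e′ ∉ E₀, and the gain becomes the new multiplier.
    module Gain {A X e e′} (cert : Certificate A X) (opt : OptimalExchangePair X Y e e′)
                (gain : ¬ (w e - w e′ ≤ 0#)) where
      open Certificate cert

      μ = w e - w e′
      e∈X = proj₁ (proj₁ (proj₁ opt))
      e′∉X = proj₁ (proj₂ (proj₁ (proj₁ opt)))
      bX′ = proj₂ (proj₂ (proj₁ (proj₁ opt)))

      localθ : LocallyMin M (penalised w E₀ θ) X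
      localθ = minBasis⇒locallyMin M minBasis

      -- An element of `E₀` enters free of fee, so the exchange would already lower the weight
      -- penalised with `θ`.
      e′∉E₀ : e′ ∉ E₀
      e′∉E₀ e′∈E₀ = gain (x≤y⇒x-y≤0
        (≤-trans (x≤x+y (penalty≥0 e 0≤θ))
        (≤-trans (subst-+≤+ refl (penalty-∈ e′∈E₀) (localθ e∈X e′∉X bX′)) (≤-reflexive (identityʳ _)))))

      -- Otherwise both elements pay `θ`, the fees cancel, and the positive gain contradicts
      -- minimality.
      e∈E₀ : e ∈ E₀
      e∈E₀ = decidable-stable (e ∈? E₀) λ e∉E₀ → gain (x≤y⇒x-y≤0 (+-cancelʳ-≤ θ
        (subst-+≤+ (penalty-∉ e∉E₀) (penalty-∉ e′∉E₀) (localθ e∈X e′∉X bX′))))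

      0≤μ : 0# ≤ μ
      0≤μ = gain≥0 basis opt

      μ≤θ : μ ≤ θ
      μ≤θ = x≤z+y⇒x-y≤z (≤-trans (x≤y+0 ≤-refl) (≤-trans
        (subst-+≤+ (penalty-∈ e∈E₀) (penalty-∉ e′∉E₀) (localθ e∈X e′∉X bX′)) (≤-reflexive (comm _ _))))

      -- Within one side of `E₀` the fee makes no difference. For an exchange back into `E₀`,
      -- lowering the fee from `θ` to `μ` makes the leaving element only cheaper. For an exchange
      -- out of `E₀`, `gain-bound` limits the gain to `μ`.
      localμ : LocallyMin M (penalised w E₀ μ) X
      localμ {d} {d′} d∈X d′∉X b with d ∈? E₀ | d′ ∈? E₀
      ... | yes d∈ | yes d′∈ = subst-+≤+ (sym (penalty-∈ d∈)) (sym (penalty-∈ d′∈))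
        (subst-+≤+ (penalty-∈ d∈) (penalty-∈ d′∈) (localθ d∈X d′∉X b))
      ... | no  d∉ | no  d′∉ = subst-+≤+ (sym (penalty-∉ d∉)) (sym (penalty-∉ d′∉))
        (+-monoˡ-≤ μ (+-cancelʳ-≤ θ (subst-+≤+ (penalty-∉ d∉) (penalty-∉ d′∉) (localθ d∈X d′∉X b))))
      ... | no  d∉ | yes d′∈ = subst-+≤+ (sym (penalty-∉ d∉)) (sym (penalty-∈ d′∈))
        (≤-trans (+-monoʳ-≤ (w d) μ≤θ) (subst-+≤+ (penalty-∉ d∉) (penalty-∈ d′∈) (localθ d∈X d′∉X b)))
      ... | yes d∈ | no  d′∉ = subst-+≤+ (sym (penalty-∈ d∈)) (sym (penalty-∉ d′∉))
        (x+0≤y ([ (λ le → ≤-trans le (x≤x+y 0≤μ)) , (λ le → ≤-trans le (≤-reflexive (comm _ _))) ]′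
               (gain-bound opt d∈X d′∉X b)))

      certificate : Certificate (A ∪ ⁅ e′ ⁆) (swap X e e′)
      certificate = record
        { θ        = μ
        ; 0≤θ      = 0≤μ
        ; minBasis = bX′ , λ Z bZ → ≤-trans (exchange-≤ (penalised w E₀ μ) e∈X e′∉X tight)
                                            (proj₂ (locallyMin⇒minBasis M basis localμ) Z bZ)
        ; outside≡ = trans (exchange-─ e∈E₀ e′∉E₀) (cong (_∪ ⁅ e′ ⁆) outside≡)
        }
        where
        tight : penalised w E₀ μ e′ ≤ penalised w E₀ μ e
        tight = subst-+≤+ (sym (penalty-∉ e′∉E₀)) (sym (penalty-∈ e∈E₀))
          (x≤y+0 (≤-reflexive (≈-trans (comm _ _) (//-rightDividesˡ (w e′) (w e)))))

      e′∉E₀∪A : e′ ∉ E₀ ∪ A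
      e′∉E₀∪A m = [ e′∉E₀ , (λ e′∈A → e′∉X (p─q⊆p X E₀ (subst (e′ ∈_) (sym outside≡) e′∈A))) ]′
                  (x∈p∪q⁻ E₀ A m)

    -- Induction along the run while the gain is positive. The last hypothesis says that the
    -- remaining iterations suffice to record as many elements as `Y` has outside `E₀`.
    greedyPrefix : ∀ {A X es X′} → Certificate A X → Steps Y X es X′ →
      ∣ Y ─ E₀ ∣ ℕ.≤ ∣ A ∣ ℕ.+ length es →
      ∃₂ λ ps qs → es ≡ ps ++ qs × Greedy A ps × (Injective _≡_ _≈_ w → qs ≡ [])
    greedyPrefix {A} cert done enough =
      -- No iteration is left, so `Y` has at most `∣ A ∣` elements outside `E₀` and the certificate
      -- compares `f A` with the minimum weight itself.
      [] , [] , refl , stop (λ Z bZ → ≤-trans (f-least Y (proj₁ minY)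
        (subst (_ ℕ.≤_) (ℕ.+-identityʳ ∣ A ∣) enough)) (proj₂ minY Z bZ)) , λ _ → refl
      where open Certificate cert
    greedyPrefix {A} cert (step {X = X} {e} {e′} {es} opt steps) enough = case (w e - w e′ ≤? 0#) of λ
      { (yes noGain) → [] , e′ ∷ es , refl
          , stop (λ Z bZ → ≤-trans (f≤weight basis X⊆E₀∪A) (proj₂ (noGain⇒minBasis basis opt noGain) Z bZ))
          -- The gain is both nonpositive and nonnegative; with distinct weights this would identify
          -- `e` in `X` with `e′` outside it.
          , λ inj → contradiction
              (subst (_∈ X) (inj (x∙y⁻¹≈ε⇒x≈y _ _ (antisym noGain (gain≥0 basis opt)))) (proj₁ (proj₁ (proj₁ opt))))
              (proj₁ (proj₂ (proj₁ (proj₁ opt))))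
      ; (no gain) →
          let open Gain cert opt gain
              e′∉A = e′∉E₀∪A ∘ q⊆p∪q E₀ A
              ps , qs , eq , greedy , noTies = greedyPrefix certificate steps
                (subst (∣ Y ─ E₀ ∣ ℕ.≤_) (trans (ℕ.+-suc ∣ A ∣ (length es))
                  (cong (ℕ._+ length es) (sym (∣p∪⁅x⁆∣ A e′∉A)))) enough)
          in e′ ∷ ps , qs , cong (e′ ∷_) eq , next e′∉E₀∪A f-least greedy , noTies
      }
      where open Certificate cert

-- Lists and the sets they enumerate

setOf : List (Fin n) → Subset n
setOf xs = ⋃ (map ⁅_⁆ xs)

take-++-≤ : ∀ {a} {A : Set a} {i} {xs ys : List A} → i ℕ.≤ length xs → take i (xs ++ ys) ≡ take i xs
take-++-≤ {i = zero}  _ = refl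
take-++-≤ {i = suc i} {x ∷ xs} (s≤s le) = cong (x ∷_) (take-++-≤ le)

setOf-take-++ : ∀ i (xs ys : List (Fin n)) → setOf (take i xs) ⊆ setOf (take i (xs ++ ys))
setOf-take-++ zero    xs       ys = id
setOf-take-++ (suc i) []       ys = ⊥⊆
setOf-take-++ (suc i) (x ∷ xs) ys =
  ∪-least (p⊆p∪q _) (q⊆p∪q ⁅ x ⁆ _ ∘ setOf-take-++ i xs ys)

-- Membership of `x` in the list is carried along because the induction needs it to separate `x`
-- from the head `y`.
take-suc-fresh : ∀ {E : Subset n} {i xs} → Unique xs → All (_∉ E) xs → i ℕ.< length xs →
  ∃ λ x → x ∈ˡ xs × x ∉ E ∪ setOf (take i xs) × setOf (take (suc i) xs) ≡ setOf (take i xs) ∪ ⁅ x ⁆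
take-suc-fresh {E = E} {zero} {x ∷ xs} _ (x∉E ∷ _) _ =
  x , here refl , (λ m → [ x∉E , ∉⊥ ]′ (x∈p∪q⁻ E ⊥ m)) , ∪-comm ⁅ x ⁆ ⊥
take-suc-fresh {E = E} {suc i} {y ∷ xs} (y≢ ∷ unique) (_ ∷ xs∉E) (s≤s lt) =
  let x , x∈ , x∉ , eq = take-suc-fresh unique xs∉E lt
      S = setOf (take i xs)
  in x , there x∈
   , (λ m → [ x∉ ∘ p⊆p∪q S
            , (λ k → [ (λ x∈y → All.lookup y≢ x∈ (sym (x∈⁅y⁆⇒x≡y y x∈y))) , x∉ ∘ q⊆p∪q E S ]′
                     (x∈p∪q⁻ ⁅ y ⁆ S k)) ]′
            (x∈p∪q⁻ E (⁅ y ⁆ ∪ S) m))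
   , trans (cong (⁅ y ⁆ ∪_) eq) (sym (∪-assoc ⁅ y ⁆ S ⁅ x ⁆))

∣setOf∣≤length : ∀ (xs : List (Fin n)) → ∣ setOf xs ∣ ℕ.≤ length xs
∣setOf∣≤length {n} [] = ℕ.≤-reflexive (∣⊥∣≡0 n)
∣setOf∣≤length (x ∷ xs) =
  ℕ.≤-trans (ℕ.≤-reflexive (cong ∣_∣ (∪-comm ⁅ x ⁆ (setOf xs))))
  (ℕ.≤-trans (∣p∪⁅x⁆∣≤1+∣p∣ (setOf xs) x) (s≤s (∣setOf∣≤length xs)))

∈ˡ⇒∈setOf : ∀ {xs : List (Fin n)} → x ∈ˡ xs → x ∈ setOf xs
∈ˡ⇒∈setOf {xs = x ∷ xs} (here refl) = p⊆p∪q (setOf xs) (x∈⁅x⁆ x)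
∈ˡ⇒∈setOf {xs = y ∷ xs} (there x∈)  = q⊆p∪q ⁅ y ⁆ (setOf xs) (∈ˡ⇒∈setOf x∈)

-- First occurrences are the ones kept, so a prefix of distinct elements survives intact.
deduplicate-++-unique : ∀ {xs : List (Fin n)} ys → Unique xs →
  ∃ λ zs → deduplicate _≟_ (xs ++ ys) ≡ xs ++ zs
deduplicate-++-unique ys [] = deduplicate _≟_ ys , refl
deduplicate-++-unique {xs = x ∷ xs} ys (x≢ ∷ unique) =
  let zs , eq = deduplicate-++-unique ys unique
  in filter (¬? ∘ (x ≟_)) zs
   , cong (x ∷_) (trans (cong (filter (¬? ∘ (x ≟_))) eq)
       (trans (filter-++ (¬? ∘ (x ≟_)) xs zs) (cong (_++ filter (¬? ∘ (x ≟_)) zs) (filter-all (¬? ∘ (x ≟_)) x≢))))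

deduplicate-unique : ∀ {xs : List (Fin n)} → Unique xs → deduplicate _≟_ xs ≡ xs
deduplicate-unique [] = refl
deduplicate-unique {xs = x ∷ xs} (x≢ ∷ unique) = cong (x ∷_)
  (trans (cong (filter (¬? ∘ (x ≟_))) (deduplicate-unique unique)) (filter-all (¬? ∘ (x ≟_)) x≢))

-- Induced sequences and their optimality

module InducedSequence
  {c ℓ₁ ℓ₂ ℓ : Level} (W : OrderedAbelianGroup c ℓ₁ ℓ₂)
  {n : ℕ} (M : Matroid n ℓ)
  (w : Fin n → OrderedAbelianGroup.Carrier W)
  (E₀ : Subset n)
  (spanning : ∃ λ B → IsBasis M B × B ⊆ E₀)
  where

  open OrderedAbelianGroup W
  open OrderedGroupProperties W using (≤-trans; sum-mono-≤)
  open IMD W M w E₀ spanning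
  open GreedyRun W M w E₀ spanning

  -- Stronger than the step condition in `Feasible`, which also allows elements to be lost.
  Growing : Sequence → Set
  Growing A = ∀ (i : Fin T) →
    ∃ λ e → e ∉ E₀ ∪ A (inject₁ i) × A (suc i) ≡ A (inject₁ i) ∪ ⁅ e ⁆

  growing⇒feasible : ∀ {A} → A zero ≡ ⊥ → Growing A → Feasible A
  growing⇒feasible {A} A₀≡⊥ growing = <-weakInduction (λ i → A i ⊆ ∁ E₀) base grow , A₀≡⊥ , single
    where
    base : A zero ⊆ ∁ E₀
    base m = contradiction (subst (_ ∈_) A₀≡⊥ m) ∉⊥
    grow : ∀ i → A (inject₁ i) ⊆ ∁ E₀ → A (suc i) ⊆ ∁ E₀
    grow i ih with growing i
    ... | e , e∉ , eq rewrite eq = ∪⁅⁆-⊆ ih (x∉p⇒x∈∁p (e∉ ∘ p⊆p∪q _))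
    single : ∀ i → ∣ A (suc i) ─ A (inject₁ i) ∣ ≡ 1
    single i with growing i
    ... | e , e∉ , eq rewrite eq =
      trans (cong ∣_∣ (p∪⁅x⁆─p≡⁅x⁆ (e∉ ∘ q⊆p∪q E₀ _))) (∣⁅x⁆∣≡1 e)

  induces⇒growing : ∀ {es A} → Unique es → All (_∉ E₀) es → Induces es A → Growing A
  induces⇒growing {es} {A} unique es∉E₀ (prefix , later) i with toℕ i ℕ.<? length es
  ... | no  ≮  = later i (ℕ.≮⇒≥ ≮)
  ... | yes lt =
    let e , _ , e∉ , eq = take-suc-fresh unique es∉E₀ lt
    in e , subst (λ S → e ∉ E₀ ∪ S) (sym Aᵢ≡) e∉
         , trans (prefix (suc i) lt) (trans eq (cong (_∪ ⁅ e ⁆) (sym Aᵢ≡)))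
    where
    Aᵢ≡ : A (inject₁ i) ≡ setOf (take (toℕ i) es)
    Aᵢ≡ = trans (prefix (inject₁ i) (subst (ℕ._≤ length es) (sym (toℕ-inject₁ i)) (ℕ.<⇒≤ lt)))
                (cong (λ k → setOf (take k es)) (toℕ-inject₁ i))

  induced : ∀ {es} → Unique es → All (_∉ E₀) es → ∃ (Induces es)
  -- The members are the prefixes of one list that starts with `es` and goes on through the other
  -- elements outside `E₀`.
  induced {es} unique es∉E₀ = (λ i → setOf (take (toℕ i) full)) , prefix , later
    where
    others = filter (λ e → ¬? (e ∈? E₀)) (allFin n)
    extension = deduplicate-++-unique others unique
    full = es ++ proj₁ extension

    ∈others : ∀ {e} → e ∉ E₀ → e ∈ˡ others
    ∈others e∉E₀ = ∈-filter⁺ (λ e → ¬? (e ∈? E₀)) (∈-allFin _) e∉E₀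

    full-unique : Unique full
    full-unique = subst Unique (proj₂ extension) (deduplicate-! _≟_ (es ++ others))

    full∉E₀ : All (_∉ E₀) full
    full∉E₀ = subst (All (_∉ E₀)) (proj₂ extension)
      (All.deduplicate⁺ _≟_ (All.++⁺ es∉E₀ (All.all-filter (λ e → ¬? (e ∈? E₀)) (allFin n))))

    T≤length : T ℕ.≤ length full
    T≤length = ℕ.≤-trans (p⊆q⇒∣p∣≤∣q∣ exhausts) (∣setOf∣≤length full)
      where
      exhausts : ∁ E₀ ⊆ setOf full
      exhausts e∈∁ = ∈ˡ⇒∈setOf (subst (_ ∈ˡ_) (proj₂ extension)
        (∈-deduplicate⁺ _≟_ (∈-++⁺ʳ es (∈others (x∈∁p⇒x∉p e∈∁)))))

    prefix : ∀ (i : Fin (suc T)) → toℕ i ℕ.≤ length es → setOf (take (toℕ i) full) ≡ setOf (take (toℕ i) es)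
    prefix i le = cong setOf (take-++-≤ le)

    later : ∀ (i : Fin T) → length es ℕ.≤ toℕ i →
      ∃ λ e → e ∉ E₀ ∪ setOf (take (toℕ (inject₁ i)) full) ×
              setOf (take (suc (toℕ i)) full) ≡ setOf (take (toℕ (inject₁ i)) full) ∪ ⁅ e ⁆
    later i _ rewrite toℕ-inject₁ i =
      let e , _ , e∉ , eq = take-suc-fresh full-unique full∉E₀ (ℕ.<-≤-trans (toℕ<n i) T≤length)
      in e , e∉ , eq

  -- Each step brings in one element but may lose others, hence an inequality.
  feasible⇒∣∣≤ : ∀ {B} → Feasible B → ∀ i → ∣ B i ∣ ℕ.≤ toℕ i
  feasible⇒∣∣≤ {B} (_ , B₀≡⊥ , single) = <-weakInduction (λ i → ∣ B i ∣ ℕ.≤ toℕ i)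
    (ℕ.≤-reflexive (trans (cong ∣_∣ B₀≡⊥) (∣⊥∣≡0 n)))
    λ i ih → ℕ.≤-trans (∣p∣≤∣p─q∣+∣q∣ (B (suc i)) (B (inject₁ i)))
      (ℕ.+-mono-≤ (ℕ.≤-reflexive (single i)) (subst (∣ B (inject₁ i) ∣ ℕ.≤_) (toℕ-inject₁ i) ih))

  f-antitone : ∀ {A A′} → A ⊆ A′ → f A′ ≤ f A
  f-antitone {A} A⊆A′ =
    let X , (bX , X⊆) , _ = best A
    in f≤weight bX (∪-least (p⊆p∪q _) (q⊆p∪q E₀ _ ∘ A⊆A′) ∘ X⊆)

  greedy-fresh : ∀ {A es} → Greedy A es → All (_∉ E₀ ∪ A) es × Unique es
  greedy-fresh (stop _) = [] , []
  greedy-fresh {A} (next {e} e∉ _ greedy) =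
    let fresh , unique = greedy-fresh greedy
    in e∉ ∷ All.map (λ x∉ → x∉ ∘ ∪-least (p⊆p∪q _) (q⊆p∪q E₀ _ ∘ p⊆p∪q ⁅ e ⁆)) fresh
     , All.map (λ { x∉ refl → x∉ (q⊆p∪q E₀ _ (x∈p∪⁅x⁆ A e)) }) fresh ∷ unique

  -- While entries of positive gain remain, the bound comes from the certificate of the current
  -- step; after `stop` the minimum over all bases is reached and further elements cannot raise `f`.
  greedy-least : ∀ {A es} → Greedy A es → ∀ j Z → IsBasis M Z → ∣ Z ─ E₀ ∣ ℕ.≤ ∣ A ∣ ℕ.+ j →
                 f (A ∪ setOf (take j es)) ≤ weight Z
  -- The case split on `j` lets `take j []` reduce.
  greedy-least (stop least) zero    Z bZ _ = ≤-trans (f-antitone (p⊆p∪q ⊥)) (least Z bZ)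
  greedy-least (stop least) (suc j) Z bZ _ = ≤-trans (f-antitone (p⊆p∪q ⊥)) (least Z bZ)
  greedy-least {A} (next _ least _) zero Z bZ le = ≤-trans (f-antitone (p⊆p∪q ⊥))
    (least Z bZ (subst (∣ Z ─ E₀ ∣ ℕ.≤_) (ℕ.+-identityʳ ∣ A ∣) le))
  greedy-least {A} (next {e} {es} e∉ _ greedy) (suc j) Z bZ le =
    subst (λ S → f S ≤ weight Z) (∪-assoc A ⁅ e ⁆ (setOf (take j es)))
      (greedy-least greedy j Z bZ (subst (∣ Z ─ E₀ ∣ ℕ.≤_) (trans (ℕ.+-suc ∣ A ∣ j)
        (cong (ℕ._+ j) (sym (∣p∪⁅x⁆∣ A (e∉ ∘ q⊆p∪q E₀ A))))) le))

  induces⇒prefix⊆ : ∀ {ps rs A} → Growing A → Induces (ps ++ rs) A →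
                    ∀ i → setOf (take (toℕ i) ps) ⊆ A i
  induces⇒prefix⊆ {ps} {rs} {A} growing (prefix , _) =
    <-weakInduction (λ i → setOf (take (toℕ i) ps) ⊆ A i) (early zero z≤n) grow
    where
    early : ∀ i → toℕ i ℕ.≤ length (ps ++ rs) → setOf (take (toℕ i) ps) ⊆ A i
    early i le = subst (setOf (take (toℕ i) ps) ⊆_) (sym (prefix i le)) (setOf-take-++ (toℕ i) ps rs)

    grow : ∀ i → setOf (take (toℕ (inject₁ i)) ps) ⊆ A (inject₁ i) →
           setOf (take (suc (toℕ i)) ps) ⊆ A (suc i)
    grow i ih with suc (toℕ i) ℕ.≤? length (ps ++ rs)
    ... | yes le = early (suc i) le
    ... | no  ≰  =
      -- Past the end of the list all of `ps` has been taken already, and the sequence only grows.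
      let e , _ , eq = growing i
      in subst (setOf (take (suc (toℕ i)) ps) ⊆_) (sym eq)
           (p⊆p∪q ⁅ e ⁆ ∘ ih ∘ ⊆-reflexive (cong setOf (trans (take-all (suc (toℕ i)) ps (ℕ.m≤n⇒m≤1+n ∣ps∣≤i))
             (sym (take-all (toℕ (inject₁ i)) ps (subst (length ps ℕ.≤_) (sym (toℕ-inject₁ i)) ∣ps∣≤i))))))
      where
      ∣ps∣≤i : length ps ℕ.≤ toℕ i
      ∣ps∣≤i = ℕ.≤-trans (length-++-≤ˡ ps) (ℕ.≤-pred (ℕ.≰⇒> ≰))

  -- The costs compare term by term: a best basis within `E₀ ∪ B i` has at most `i` elements outside
  -- `E₀`, and `A i` contains the first `i` entries of `ps`.
  greedy⇒optimal : ∀ {ps rs A} → Greedy ⊥ ps → Growing A → Induces (ps ++ rs) A → Optimal A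
  greedy⇒optimal {ps} {A = A} greedy growing induces@(prefix , _) =
    growing⇒feasible (prefix zero z≤n) growing , λ B feasible → sum-mono-≤ (f≤f feasible)
    where
    f≤f : ∀ {B} → Feasible B → ∀ i → f (A i) ≤ f (B i)
    f≤f {B} feasible i =
      let Z , (bZ , Z⊆) , _ = best (B i)
          Z─E₀⊆B : Z ─ E₀ ⊆ B i
          Z─E₀⊆B m = [ (λ z∈E₀ → contradiction z∈E₀ (x∈p─q⇒x∉q Z E₀ m)) , id ]′
                     (x∈p∪q⁻ E₀ (B i) (Z⊆ (p─q⊆p Z E₀ m)))
          ∣Z─E₀∣≤i = ℕ.≤-trans (p⊆q⇒∣p∣≤∣q∣ Z─E₀⊆B) (feasible⇒∣∣≤ feasible i)
      in ≤-trans (f-antitone (∪-least ⊥⊆ (induces⇒prefix⊆ growing induces i)))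
           (greedy-least greedy (toℕ i) Z bZ
             (subst (λ k → ∣ Z ─ E₀ ∣ ℕ.≤ k ℕ.+ toℕ i) (sym (∣⊥∣≡0 n)) ∣Z─E₀∣≤i))

  proper-∉E₀ : ∀ es → All (_∉ E₀) (proper es)
  proper-∉E₀ es = All.deduplicate⁺ _≟_ (All.all-filter (λ e → ¬? (e ∈? E₀)) es)

  proper-unique : ∀ es → Unique (proper es)
  proper-unique es = deduplicate-! _≟_ (filter (λ e → ¬? (e ∈? E₀)) es)

  -- The entries of positive gain are never dropped, so `proper` can alter only what follows them.
  proper-prefix : ∀ {ps} qs → All (_∉ E₀) ps → Unique ps → ∃ λ rs → proper (ps ++ qs) ≡ ps ++ rs
  proper-prefix {ps} qs ps∉E₀ unique =
    let rs , eq = deduplicate-++-unique (filter new? qs) unique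
    in rs , trans (cong (deduplicate _≟_) (trans (filter-++ new? ps qs)
                    (cong (_++ filter new? qs) (filter-all new? ps∉E₀)))) eq
    where
    new? = λ e → ¬? (e ∈? E₀)

  proper-fixed : ∀ {ps} → All (_∉ E₀) ps → Unique ps → proper ps ≡ ps
  proper-fixed ps∉E₀ unique =
    trans (cong (deduplicate _≟_) (filter-all (λ e → ¬? (e ∈? E₀)) ps∉E₀)) (deduplicate-unique unique)

  output⇒optimal : ∀ {X Y} → IsMinWeightBasis (restrict M E₀) X → IsMinWeightBasis M Y →
    ∀ es → Output X Y es →
    (∃ λ A → Induces (proper es) A) ×
    (∀ A → Induces (proper es) A → Optimal A) ×
    (Injective _≡_ _≈_ w → proper es ≡ es)
  output⇒optimal {X} {Y} minX minY es (∣es∣≡ , _ , steps) =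
    induced unique es∉E₀ ,
    (λ A induces → greedy⇒optimal greedy (induces⇒growing unique es∉E₀ induces)
                     (subst (λ us → Induces us A) proper≡ induces)) ,
    λ inj → trans (cong proper (es≡ps inj)) (trans (proper-fixed ps∉E₀ ps-unique) (sym (es≡ps inj)))
    where
    unique = proper-unique es
    es∉E₀ = proper-∉E₀ es

    -- The initial `X` lies in `E₀`, so the number of iterations covers all elements of `Y` outside
    -- `E₀`.
    Y─E₀⊆Y─X : Y ─ E₀ ⊆ Y ─ X
    Y─E₀⊆Y─X m = x∈p∧x∉q⇒x∈p─q (p─q⊆p Y E₀ m) (x∈p─q⇒x∉q Y E₀ m ∘ proj₂ (proj₁ (proj₁ minX)))

    enough : ∣ Y ─ E₀ ∣ ℕ.≤ ∣ ⊥ {n} ∣ ℕ.+ length es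
    enough = subst (λ k → ∣ Y ─ E₀ ∣ ℕ.≤ k ℕ.+ length es) (sym (∣⊥∣≡0 n))
      (subst (∣ Y ─ E₀ ∣ ℕ.≤_) (sym ∣es∣≡) (p⊆q⇒∣p∣≤∣q∣ Y─E₀⊆Y─X))

    result = greedyPrefix minY (initialCertificate minX) steps enough
    ps = proj₁ result
    qs = proj₁ (proj₂ result)
    es≡ = proj₁ (proj₂ (proj₂ result))
    greedy = proj₁ (proj₂ (proj₂ (proj₂ result)))

    ps∉E₀ = All.map (λ e∉ → e∉ ∘ p⊆p∪q ⊥) (proj₁ (greedy-fresh greedy))
    ps-unique = proj₂ (greedy-fresh greedy)

    proper≡ : proper es ≡ ps ++ proj₁ (proper-prefix qs ps∉E₀ ps-unique)
    proper≡ = trans (cong proper es≡) (proj₂ (proper-prefix qs ps∉E₀ ps-unique))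

    es≡ps : Injective _≡_ _≈_ w → es ≡ ps
    es≡ps inj = trans es≡ (trans (cong (ps ++_) (proj₂ (proj₂ (proj₂ (proj₂ result))) inj)) (++-identityʳ ps))

  neverStuck : ∀ {X Y} → IsMinWeightBasis (restrict M E₀) X → IsMinWeightBasis M Y →
    ∀ es X′ → Steps Y X es X′ → length es ℕ.< ∣ Y ─ X ∣ → ∃₂ λ e e′ → OptimalExchangePair X′ Y e e′
  neverStuck {X} {Y} minX minY es X′ steps lt =
    let bX′ , le = steps-progress minY steps (basis-restrict⁻ (proj₁ minX))
    in optimalPair minY bX′ (ℕ.+-cancelˡ-< (length es) 0 _
         (subst (ℕ._< length es ℕ.+ ∣ Y ─ X′ ∣) (sym (ℕ.+-identityʳ (length es))) (ℕ.<-≤-trans lt le)))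

corollary1 : ∀ {c ℓ₁ ℓ₂ ℓ : Level} (W : OrderedAbelianGroup c ℓ₁ ℓ₂)
    {n : ℕ} (M : Matroid n ℓ) (w : Fin n → OrderedAbelianGroup.Carrier W)
    (E₀ : Subset n) (spanning : ∃ λ B → IsBasis M B × B ⊆ E₀) →
    let open IMD W M w E₀ spanning in
    ∀ X Y → IsMinWeightBasis (restrict M E₀) X → IsMinWeightBasis M Y →
    (∀ es X′ → Steps Y X es X′ → length es < ∣ Y ─ X ∣ →
    ∃₂ λ e e′ → OptimalExchangePair X′ Y e e′) ×
    (∀ es → Output X Y es →
    (∃ λ A → Induces (proper es) A) ×
    (∀ A → Induces (proper es) A → Optimal A) ×
    (Injective _≡_ (OrderedAbelianGroup._≈_ W) w → proper es ≡ es))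
corollary1 W M w E₀ spanning X Y minX minY = neverStuck minX minY , output⇒optimal minX minY
  where open InducedSequence W M w E₀ spanning
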